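{- Let $q$ be a prime power, let $r\ge 2$ be an even integer, and let $a\in\mathrm{GF}(q^2)^*$, $b\in\mathrm{GF}(q^2)\setminus\mathrm{GF}(q)$. Suppose that either $q$ is odd and $4a^{q+1}+(b^q-b)^2$ is a non-zero square in $\mathrm{GF}(q)$, or $q$ is even and $\mathrm{Tr}_q\big(a^{q+1}/(b^q+b)^2\big)=1$. Let $\mathcal{B}(a,b)$ be the set of points $(x_1,\dots,x_r)$ of $\mathrm{AG}(r,q^2)$ satisfying \[x_r^q-x_r+a^q(x_1^{2q}+\dots+x_{r-1}^{2q})-a(x_1^2+\dots+x_{r-1}^2)=(b^q-b)(x_1^{q+1}+\dots+x_{r-1}^{q+1}).\] Then $|\mathcal{B}(a,b)|=q^{2r-1}$ and $\mathcal{B}(a,b)$ is a three-character set with characters \[q^{2r-3}-q^{r-2},\quad q^{2r-3},\quad q^{2r-3}-q^{r-2}+q^{r-1},\] i.e. every hyperplane of $\mathrm{AG}(r,q^2)$ meets $\mathcal{B}(a,b)$ in one of these numbers of points. Moreover, $\mathcal{B}(a,b)$ is a minimal intersection set with respect to hyperplanes (a minimal $(q^{2r-3}-q^{r-2})$-intersection set).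
   Context: For $q=2^h$, $\mathrm{Tr}_q:\mathrm{GF}(q)\to\mathrm{GF}(2)$ is the absolute trace $x\mapsto x+x^2+x^{2^2}+\dots+x^{2^{h-1}}$. A set $S$ of points of $\mathrm{AG}(r,q^2)$ is a $t$-intersection set if every hyperplane contains at least $t>0$ points of $S$; a point $P\in S$ is essential if $S\setminus\{P\}$ is not a $t$-intersection set; $S$ is minimal if all its points are essential. A set is an $m$-character set if its intersection sizes with hyperplanes take only $m$ possible values (the characters). -}

module Defs where

open import Data.Nat as ℕ using (ℕ; zero; suc; _≤_; _<_)
open import Data.Fin using (Fin; zero; suc; fromℕ; inject₁; toℕ)
open import Data.Fin.Properties using (all?)
open import Data.Bool using (Bool; true; false; if_then_else_; _∧_; not)
open import Data.List using (List; map; tabulate)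
open import Data.Nat.ListAction using (sum)
open import Data.Product using (Σ; _×_; ∃; _,_)
open import Relation.Binary.PropositionalEquality using (_≡_; _≢_)
open import Relation.Binary.Definitions using (DecidableEquality)
open import Relation.Nullary using (¬_)
open import Relation.Nullary.Decidable using (⌊_⌋)
open import Algebra.Structures using (IsCommutativeRing)
open import Function.Bundles using (_↔_; Inverse)

record FiniteField : Set₁ where
  infixl 7 _*_
  infixl 6 _+_
  infix 8 -_
  field
    Carrier   : Set
    _+_ _*_   : Carrier → Carrier → Carrier
    -_        : Carrier → Carrier
    0# 1#     : Carrier
    _⁻¹       : Carrier → Carrier
    isCommutativeRing : IsCommutativeRing _≡_ _+_ _*_ -_ 0# 1#
    0≢1       : 0# ≢ 1#
    ⁻¹-inverse : ∀ x → x ≢ 0# → x * (x ⁻¹) ≡ 1#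
    _≟_       : DecidableEquality Carrier
    size      : ℕ
    enum      : Fin size ↔ Carrier

module FF (F : FiniteField) where
  open FiniteField F

  infixr 9 _^_
  infixl 6 _-_

  _^_ : Carrier → ℕ → Carrier
  x ^ zero  = 1#
  x ^ suc n = x * (x ^ n)

  _-_ : Carrier → Carrier → Carrier
  x - y = x + (- y)

  _/_ : Carrier → Carrier → Carrier
  x / y = x * (y ⁻¹)

  four : Carrier
  four = 1# + 1# + 1# + 1#

  sumFin : (n : ℕ) → (Fin n → Carrier) → Carrier
  sumFin zero    f = 0#
  sumFin (suc n) f = f zero + sumFin n (λ i → f (suc i))

  elems : List Carrier
  elems = tabulate (Inverse.to enum)

  Point : ℕ → Set
  Point r = Fin r → Carrier

  PointSet : ℕ → Set
  PointSet r = Point r → Bool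

  cons : ∀ {r} → Carrier → Point r → Point (suc r)
  cons x v zero    = x
  cons x v (suc i) = v i

  count : (r : ℕ) → PointSet r → ℕ
  count zero    S = if S (λ ()) then 1 else 0
  count (suc r) S = sum (map (λ x → count r (λ v → S (cons x v))) elems)

  record Hyperplane (r : ℕ) : Set where
    field
      coeff   : Point r
      const   : Carrier
      nonzero : ∃ λ i → coeff i ≢ 0#

  onHyperplane : ∀ {r} → Hyperplane r → PointSet r
  onHyperplane {r} H x = ⌊ sumFin r (λ i → Hyperplane.coeff H i * x i) ≟ Hyperplane.const H ⌋

  meetCount : ∀ {r} → Hyperplane r → PointSet r → ℕ
  meetCount {r} H S = count r (λ x → onHyperplane H x ∧ S x)

  samePoint : ∀ {r} → Point r → Point r → Bool
  samePoint u v = ⌊ all? (λ i → u i ≟ v i) ⌋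

  remove : ∀ {r} → PointSet r → Point r → PointSet r
  remove S P x = S x ∧ not (samePoint x P)

  IsIntersectionSet : ∀ {r} → ℕ → PointSet r → Set
  IsIntersectionSet t S = 0 < t × (∀ H → t ≤ meetCount H S)

  IsEssential : ∀ {r} → ℕ → PointSet r → Point r → Set
  IsEssential t S P = ¬ IsIntersectionSet t (remove S P)

  IsMinimalIntersectionSet : ∀ {r} → ℕ → PointSet r → Set
  IsMinimalIntersectionSet t S =
    IsIntersectionSet t S × (∀ P → S P ≡ true → IsEssential t S P)

  -- GF(q) inside GF(q²): fixed points of x ↦ x^q
  InSubfield : ℕ → Carrier → Set
  InSubfield q x = x ^ q ≡ x

  IsSquareIn : ℕ → Carrier → Set
  IsSquareIn q c = ∃ λ y → InSubfield q y × y * y ≡ c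

  -- absolute trace Tr_q for q = 2^h : x + x^2 + … + x^(2^(h-1))
  Tr : ℕ → Carrier → Carrier
  Tr h x = sumFin h (λ i → x ^ (2 ℕ.^ toℕ i))

  Bset : ℕ → Carrier → Carrier → (r : ℕ) → PointSet r
  Bset q a b zero    x = false
  Bset q a b (suc m) x =
    ⌊ (xr ^ q - xr + (a ^ q) * sumFin m (λ i → xi i ^ (2 ℕ.* q))
                   - a * sumFin m (λ i → xi i ^ 2))
      ≟ ((b ^ q - b) * sumFin m (λ i → xi i ^ (q ℕ.+ 1))) ⌋
    where
      xr : Carrier
      xr = x (fromℕ m)
      xi : Fin m → Carrier
      xi i = x (inject₁ i)

  OddCondition : ℕ → Carrier → Carrier → Set
  OddCondition q a b =
    (four * (a ^ (q ℕ.+ 1)) + (b ^ q - b) ^ 2 ≢ 0#)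
    × IsSquareIn q (four * (a ^ (q ℕ.+ 1)) + (b ^ q - b) ^ 2)

  EvenCondition : ℕ → ℕ → Carrier → Carrier → Set
  EvenCondition h q a b = Tr h ((a ^ (q ℕ.+ 1)) / ((b ^ q + b) ^ 2)) ≡ 1#

{-# OPTIONS --safe #-}

-- Write σ x = x ^ q. The equation of B(a,b) says that x_r ^ q - x_r + Σ f(x_i) = 0, where
-- f(x) = σ a (σ x)² - a x² - (σ b - b) x σ x takes values in the q-element set {c : σ c = - c}.
-- The condition on a and b says that f splits as σ a (σ x - y₁ x)(σ x - y₂ x) with y₁ ≠ y₂ of norm 1,
-- i.e. that f is a hyperbolic form over GF(q): it takes the value 0 exactly 2q - 1 times and
-- every other skew value q - 1 times. Hence Σ f(x_i) over r - 1 coordinates takes each skew value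
-- equally often, except for q ^ (r - 1) additional zeros. A hyperplane parallel to the x_r-axis is met in
-- q points over each point of its base; on any other hyperplane the linear terms are
-- absorbed by a translation, since the polar form of f is non-degenerate, and what remains is a fibre of Σ f.
-- Choosing the translation so that this fibre is not the zero fibre gives, through each point of B(a,b),
-- a hyperplane with the least number of points, whence minimality.

module Submission where

-- The subfield GF(q) is never formed as a type: all counting takes place inside GF(q²), as sums of
-- 0/1 indicators, and its place is taken by skew elements and by solution sets of equations in `σ`.
-- The obstacle is to obtain exact fibre sizes without dimension theory. For the map from x to
-- `σ x - y * x`, the degree of a polynomial bounds every fibre by q; when y has norm 1, the values
-- lie in a set that is itself bounded by q in the same way, so the q² points leave no slack. The
-- numbers y₁, y₂ are the roots of `σ a` T² - (`σ b - b`) T - a. Odd and even characteristic differ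
-- only in how these roots are found: by the quadratic formula when q is odd, and through an
-- equation Z² + Z = κ when q is even, where the trace condition supplies a solution that
-- conjugation sends to the other one. Everything afterwards uses only their sum, product, norms and
-- distinctness. Non-degeneracy of the polar form comes from distinctness as well, because its
-- determinant is the square of `σ a * (y₁ - y₂)`.

open import Level using (0ℓ)
open import Algebra.Bundles using (CommutativeMonoid; CommutativeRing)

-- A ring solver with integer coefficients.

module IntegerSolver (R : CommutativeRing 0ℓ 0ℓ) where

  open import Data.Nat.Base as ℕ using (ℕ; zero; suc)
  open import Data.Integer.Base as ℤ using (ℤ; +_; -[1+_]; _⊖_)
  import Data.Integer.Properties as ℤ
  import Data.Nat.Properties as ℕ
  open import Data.Maybe.Base using (Maybe; just; nothing)
  open import Relation.Nullary using (yes; no)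
  import Relation.Binary.PropositionalEquality as ≡
  open import Algebra.Solver.Ring.AlmostCommutativeRing
    using (fromCommutativeRing; _-Raw-AlmostCommutative⟶_)
  open CommutativeRing R
  open import Algebra.Properties.Ring ring
  open import Algebra.Properties.AbelianGroup +-abelianGroup using (⁻¹-∙-comm)
  open import Algebra.Properties.Semiring.Mult semiring using (_×_; ×-homo-+; ×1-homo-*)
  open import Relation.Binary.Reasoning.Setoid setoid

  -- The separate clause for one lets `con 1ℤ` evaluate to `1#` itself instead of `1# + 0#`, so that
  -- `1-homo` is `refl` and solver equations match goals that contain `1#`.
  fromℕ : ℕ → Carrier
  fromℕ zero          = 0#
  fromℕ (suc zero)    = 1#
  fromℕ (suc (suc n)) = 1# + fromℕ (suc n)

  fromℕ-× : ∀ n → fromℕ n ≈ n × 1#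
  fromℕ-× zero          = refl
  fromℕ-× (suc zero)    = sym (+-identityʳ 1#)
  fromℕ-× (suc (suc n)) = +-congˡ (fromℕ-× (suc n))

  fromℤ : ℤ → Carrier
  fromℤ (+ n)    = fromℕ n
  fromℤ -[1+ n ] = - fromℕ (suc n)

  fromℕ-+ : ∀ m n → fromℕ (m ℕ.+ n) ≈ fromℕ m + fromℕ n
  fromℕ-+ m n = begin
    fromℕ (m ℕ.+ n)     ≈⟨ fromℕ-× (m ℕ.+ n) ⟩
    (m ℕ.+ n) × 1#      ≈⟨ ×-homo-+ 1# m n ⟩
    m × 1# + n × 1#     ≈⟨ +-cong (fromℕ-× m) (fromℕ-× n) ⟨
    fromℕ m + fromℕ n   ∎

  fromℕ-* : ∀ m n → fromℕ (m ℕ.* n) ≈ fromℕ m * fromℕ n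
  fromℕ-* m n = begin
    fromℕ (m ℕ.* n)     ≈⟨ fromℕ-× (m ℕ.* n) ⟩
    (m ℕ.* n) × 1#      ≈⟨ ×1-homo-* m n ⟩
    (m × 1#) * (n × 1#) ≈⟨ *-cong (fromℕ-× m) (fromℕ-× n) ⟨
    fromℕ m * fromℕ n   ∎

  fromℤ-neg : ∀ i → fromℤ (ℤ.- i) ≈ - fromℤ i
  fromℤ-neg (+ zero)  = sym -0#≈0#
  fromℤ-neg (+ suc n) = refl
  fromℤ-neg -[1+ n ]  = sym (-‿involutive _)

  fromℤ-⊖ : ∀ m n → fromℤ (m ⊖ n) ≈ fromℕ m - fromℕ n
  fromℤ-⊖ m       zero    = begin
    fromℕ m       ≈⟨ +-identityʳ _ ⟨
    fromℕ m + 0#  ≈⟨ +-congˡ -0#≈0# ⟨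
    fromℕ m - 0#  ∎
  fromℤ-⊖ zero    (suc n) = sym (+-identityˡ _)
  fromℤ-⊖ (suc m) (suc n) = begin
    fromℤ (suc m ⊖ suc n)                   ≡⟨ ≡.cong fromℤ (ℤ.[1+m]⊖[1+n]≡m⊖n m n) ⟩
    fromℤ (m ⊖ n)                           ≈⟨ fromℤ-⊖ m n ⟩
    fromℕ m - fromℕ n                       ≈⟨ +-congˡ (+-identityˡ _) ⟨
    fromℕ m + (0# - fromℕ n)                ≈⟨ +-congˡ (+-congʳ (-‿inverseʳ 1#)) ⟨
    fromℕ m + (1# - 1# - fromℕ n)           ≈⟨ +-congˡ (+-assoc _ _ _) ⟩
    fromℕ m + (1# + (- 1# - fromℕ n))       ≈⟨ +-assoc _ _ _ ⟨
    fromℕ m + 1# + (- 1# - fromℕ n)         ≈⟨ +-cong (+-comm _ _) (⁻¹-∙-comm _ _) ⟩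
    1# + fromℕ m - (1# + fromℕ n)           ≈⟨ +-cong (fromℕ-+ 1 m) (-‿cong (fromℕ-+ 1 n)) ⟨
    fromℕ (suc m) - fromℕ (suc n)           ∎

  fromℤ-+ : ∀ i j → fromℤ (i ℤ.+ j) ≈ fromℤ i + fromℤ j
  fromℤ-+ (+ m)    (+ n)    = fromℕ-+ m n
  fromℤ-+ (+ m)    -[1+ n ] = fromℤ-⊖ m (suc n)
  fromℤ-+ -[1+ m ] (+ n)    = trans (fromℤ-⊖ n (suc m)) (+-comm _ _)
  fromℤ-+ -[1+ m ] -[1+ n ] = begin
    - fromℕ (suc (suc (m ℕ.+ n)))       ≡⟨ ≡.cong (λ k → - fromℕ (suc k)) (≡.sym (ℕ.+-suc m n)) ⟩
    - fromℕ (suc m ℕ.+ suc n)           ≈⟨ -‿cong (fromℕ-+ (suc m) (suc n)) ⟩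
    - (fromℕ (suc m) + fromℕ (suc n))   ≈⟨ ⁻¹-∙-comm _ _ ⟨
    - fromℕ (suc m) - fromℕ (suc n)     ∎

  fromℤ-*-pos : ∀ m j → fromℤ (+ m ℤ.* j) ≈ fromℕ m * fromℤ j
  fromℤ-*-pos m (+ n)    = trans (reflexive (≡.cong fromℤ (≡.sym (ℤ.pos-* m n)))) (fromℕ-* m n)
  fromℤ-*-pos m -[1+ n ] = begin
    fromℤ (+ m ℤ.* (ℤ.- (+ suc n)))   ≡⟨ ≡.cong fromℤ (≡.sym (ℤ.neg-distribʳ-* (+ m) (+ suc n))) ⟩
    fromℤ (ℤ.- (+ m ℤ.* + suc n))     ≈⟨ fromℤ-neg (+ m ℤ.* + suc n) ⟩
    - fromℤ (+ m ℤ.* + suc n)         ≈⟨ -‿cong (fromℤ-*-pos m (+ suc n)) ⟩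
    - (fromℕ m * fromℕ (suc n))       ≈⟨ -‿distribʳ-* _ _ ⟩
    fromℕ m * - fromℕ (suc n)         ∎

  fromℤ-* : ∀ i j → fromℤ (i ℤ.* j) ≈ fromℤ i * fromℤ j
  fromℤ-* (+ m)    j = fromℤ-*-pos m j
  fromℤ-* -[1+ m ] j = begin
    fromℤ ((ℤ.- (+ suc m)) ℤ.* j)   ≡⟨ ≡.cong fromℤ (≡.sym (ℤ.neg-distribˡ-* (+ suc m) j)) ⟩
    fromℤ (ℤ.- (+ suc m ℤ.* j))     ≈⟨ fromℤ-neg (+ suc m ℤ.* j) ⟩
    - fromℤ (+ suc m ℤ.* j)         ≈⟨ -‿cong (fromℤ-*-pos (suc m) j) ⟩
    - (fromℕ (suc m) * fromℤ j)     ≈⟨ -‿distribˡ-* _ _ ⟩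
    - fromℕ (suc m) * fromℤ j       ∎

  fromℤ-morphism : ℤ.+-*-rawRing -Raw-AlmostCommutative⟶ fromCommutativeRing R
  fromℤ-morphism = record
    { ⟦_⟧    = fromℤ
    ; +-homo = fromℤ-+
    ; *-homo = fromℤ-*
    ; -‿homo = fromℤ-neg
    ; 0-homo = refl
    ; 1-homo = refl
    }

  fromℤ-≈? : ∀ i j → Maybe (fromℤ i ≈ fromℤ j)
  fromℤ-≈? i j with i ℤ.≟ j
  ... | yes i≡j = just (reflexive (≡.cong fromℤ i≡j))
  ... | no  _   = nothing

  open import Algebra.Solver.Ring ℤ.+-*-rawRing (fromCommutativeRing R) fromℤ-morphism fromℤ-≈? public
    using (solve; con; _:=_; _:+_; _:*_; _:-_; :-_)

-- Binomial coefficients modulo a prime.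

module PrimeBinomial where

  open import Data.Nat using (zero; suc; _*_; _∸_; _<_; _!)
  open import Data.Nat.Properties using (<⇒≤; <-trans; n<1+n; ∸-monoʳ-<; _!*_!≢0)
  open import Data.Nat.Combinatorics using (_C_; k![n∸k]!∣n!)
  open import Data.Nat.Combinatorics.Specification using (nCk≡n!/k![n-k]!)
  open import Data.Nat.Divisibility using (_∣_; _∤_; ∣1⇒≡1; >⇒∤; m∣m*n)
  open import Data.Nat.DivMod using (m/n*n≡m)
  open import Data.Nat.Primality using (Prime; euclidsLemma; ¬prime[1]; ¬prime[0])
  open import Data.Empty using (⊥-elim)
  open import Data.Sum using (inj₁; inj₂)
  open import Relation.Binary.PropositionalEquality using (_≡_; sym; trans; cong; subst)

  prime∤! : ∀ {p} → Prime p → ∀ k → k < p → p ∤ k !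
  prime∤! pp zero    k<p p∣ = ¬prime[1] (subst Prime (∣1⇒≡1 p∣) pp)
  prime∤! pp (suc k) k<p p∣ with euclidsLemma (suc k) (k !) pp p∣
  ... | inj₁ p∣1+k = >⇒∤ k<p p∣1+k
  ... | inj₂ p∣k!  = prime∤! pp k (<-trans (n<1+n k) k<p) p∣k!

  -- The product of the coefficient with k! and (p - k)! is p!, a multiple of p, while both
  -- factorials are products of numbers below p.
  prime∣C : ∀ {p} → Prime p → ∀ k → 0 < k → k < p → p ∣ p C k
  prime∣C {zero}      pp k 0<k k<p = ⊥-elim (¬prime[0] pp)
  prime∣C {p@(suc n)} pp k 0<k k<p with euclidsLemma (p C k) (k ! * (p ∸ k) !) pp p∣C*[k!*[p-k]!]
    where
    C*[k!*[p-k]!]≡p! : (p C k) * (k ! * (p ∸ k) !) ≡ p !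
    C*[k!*[p-k]!]≡p! = trans (cong (_* (k ! * (p ∸ k) !)) (nCk≡n!/k![n-k]! (<⇒≤ k<p)))
                             (m/n*n≡m {{k !* (p ∸ k) !≢0}} (k![n∸k]!∣n! (<⇒≤ k<p)))
    p∣C*[k!*[p-k]!] : p ∣ (p C k) * (k ! * (p ∸ k) !)
    p∣C*[k!*[p-k]!] = subst (p ∣_) (sym C*[k!*[p-k]!]≡p!) (m∣m*n (n !))
  ... | inj₁ p∣C = p∣C
  ... | inj₂ p∣  with euclidsLemma (k !) ((p ∸ k) !) pp p∣
  ...   | inj₁ p∣k!     = ⊥-elim (prime∤! pp k k<p p∣k!)
  ...   | inj₂ p∣[p-k]! = ⊥-elim (prime∤! pp (p ∸ k) (∸-monoʳ-< 0<k (<⇒≤ k<p)) p∣[p-k]!)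

open import Defs
open import Data.Bool using (Bool; true; false; if_then_else_; _∧_; not)
open import Data.Empty using (⊥-elim)
open import Data.Fin using (Fin; zero; suc; inject₁; fromℕ; toℕ)
import Data.Fin.Properties as Fin
open import Data.Fin.Relation.Unary.Top using (view; ‵fromℕ; ‵inject₁)
open import Data.Integer.Base using (1ℤ)
open import Data.List using (map; tabulate)
import Data.List.Properties as List
open import Data.Nat as ℕ using (ℕ; zero; suc; z≤n; s≤s)
open import Data.Nat.Combinatorics using (_C_; nCn≡1)
open import Data.Nat.Divisibility using (_∣_; divides; ∣1⇒≡1)
import Data.Nat.ListAction as List
open import Data.Nat.Primality using (Prime; ¬prime[0]; prime[2]; euclidsLemma; prime⇒irreducible; prime⇒nonZero; prime⇒nonTrivial)
import Data.Nat.Properties as ℕ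
open import Data.Product using (∃; _×_; _,_; proj₁; proj₂)
open import Data.Sum using (_⊎_; inj₁; inj₂; [_,_]′)
open import Function.Base using (_∘_)
open import Function.Bundles using (Inverse; mk↔ₛ′)
open import Relation.Nullary using (¬_; Dec; yes; no)
open import Relation.Nullary.Decidable using (⌊_⌋; map′; _×-dec_; ¬?; decidable-stable)
open import Relation.Binary.PropositionalEquality
  using (_≡_; _≢_; _≗_; refl; sym; trans; cong; cong₂; subst; subst₂; module ≡-Reasoning)
open PrimeBinomial

-- Sums over the field and counting by indicators.

module FiniteSums (F : FiniteField) where

  open FiniteField F public
  open FF F public

  commutativeRing : CommutativeRing 0ℓ 0ℓ
  commutativeRing = record { isCommutativeRing = isCommutativeRing }

  open CommutativeRing commutativeRing public using
    ( +-comm; +-assoc; +-identityˡ; +-identityʳ; -‿inverseˡ; -‿inverseʳ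
    ; *-comm; *-assoc; *-identityˡ; *-identityʳ; zeroˡ; zeroʳ; distribˡ; distribʳ
    ; +-commutativeMonoid; *-commutativeMonoid; commutativeSemiring; semiring; ring )

  from : Carrier → Fin size
  from = Inverse.from enum

  at : Fin size → Carrier
  at = Inverse.to enum

  at-from : ∀ x → at (from x) ≡ x
  at-from x = Inverse.inverseˡ enum refl

  from-at : ∀ i → from (at i) ≡ i
  from-at i = Inverse.inverseʳ enum refl

  any? : {P : Carrier → Set} → (∀ x → Dec (P x)) → Dec (∃ P)
  any? {P} P? = map′ (λ (i , p) → at i , p)
                 (λ (x , p) → from x , subst P (sym (at-from x)) p)
                 (Fin.any? (P? ∘ at))

  -- Generic because three monoids occur: natural numbers for counting, multiplication of the field
  -- for `x ^ size ≡ x`, and its addition for the characteristic.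
  module CarrierSum (M : CommutativeMonoid 0ℓ 0ℓ) where
    open CommutativeMonoid M using (_≈_; _∙_; ε; identityˡ; identityʳ; ∙-congˡ; setoid)
      renaming (Carrier to A; refl to ≈-refl; sym to ≈-sym; trans to ≈-trans; reflexive to ≈-reflexive)
    open import Algebra.Properties.CommutativeMonoid.Sum M
    open import Relation.Binary.Reasoning.Setoid setoid

    ∑ᴹ : (Carrier → A) → A
    ∑ᴹ f = sum (f ∘ at)

    ∑ᴹ-reindex : ∀ f (g h : Carrier → Carrier) → (∀ x → g (h x) ≡ x) → (∀ x → h (g x) ≡ x) →
                 ∑ᴹ f ≈ ∑ᴹ (f ∘ g)
    ∑ᴹ-reindex f g h gh hg = begin
      sum (f ∘ at)                                ≈⟨ sum-permute (f ∘ at) π ⟩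
      sum (λ i → f (at (from (g (at i)))))        ≡⟨ sum-cong-≗ (λ i → cong f (at-from (g (at i)))) ⟩
      sum (f ∘ g ∘ at)                            ∎
      where
      conj-inverse : ∀ k l → (∀ x → k (l x) ≡ x) → ∀ i → from (k (at (from (l (at i))))) ≡ i
      conj-inverse k l kl i = trans (cong (from ∘ k) (at-from _)) (trans (cong from (kl _)) (from-at i))
      π = mk↔ₛ′ (from ∘ g ∘ at) (from ∘ h ∘ at) (conj-inverse g h gh) (conj-inverse h g hg)

    sum-single : ∀ {n} (t : Fin n → A) i → (∀ j → j ≢ i → t j ≈ ε) → sum t ≈ t i
    sum-single {suc n} t zero    t≈ε = begin
      t zero ∙ sum (t ∘ suc)      ≈⟨ ∙-congˡ (sum-cong-≋ (λ j → t≈ε (suc j) λ ())) ⟩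
      t zero ∙ sum {n} (λ _ → ε)  ≈⟨ ∙-congˡ (sum-replicate-zero n) ⟩
      t zero ∙ ε                  ≈⟨ identityʳ _ ⟩
      t zero                      ∎
    sum-single {suc n} t (suc i) t≈ε = begin
      t zero ∙ sum (t ∘ suc)      ≈⟨ CommutativeMonoid.∙-congʳ M (t≈ε zero λ ()) ⟩
      ε ∙ sum (t ∘ suc)           ≈⟨ identityˡ _ ⟩
      sum (t ∘ suc)               ≈⟨ sum-single (t ∘ suc) i (λ j j≢i → t≈ε (suc j) (j≢i ∘ Fin.suc-injective)) ⟩
      t (suc i)                   ∎

    ∑ᴹ-single : ∀ f x → (∀ y → y ≢ x → f y ≈ ε) → ∑ᴹ f ≈ f x
    ∑ᴹ-single f x f≈ε = ≈-trans
      (sum-single (f ∘ at) (from x) λ j j≢ → f≈ε (at j) λ atj≡x → j≢ (trans (sym (from-at j)) (cong from atj≡x)))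
      (≈-reflexive (cong f (at-from x)))

  open CarrierSum ℕ.+-0-commutativeMonoid
  open import Algebra.Properties.Semiring.Sum ℕ.+-*-semiring
    using (sum; ∑-distrib-+; ∑-comm; *-distribˡ-sum; sum-replicate)

  -- The sum in the shape in which it occurs in `count`.
  ∑ : (Carrier → ℕ) → ℕ
  ∑ f = List.sum (map f elems)

  ∑-∑ᴹ : ∀ f → ∑ f ≡ ∑ᴹ f
  ∑-∑ᴹ f = trans (cong List.sum (List.map-tabulate at f)) (sum-tabulate (f ∘ at))
    where
    sum-tabulate : ∀ {n} (t : Fin n → ℕ) → List.sum (tabulate t) ≡ sum t
    sum-tabulate {zero}  t = refl
    sum-tabulate {suc n} t = cong (t zero ℕ.+_) (sum-tabulate (t ∘ suc))

  ∑-cong : ∀ {f g} → (∀ x → f x ≡ g x) → ∑ f ≡ ∑ g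
  ∑-cong f≗g = cong List.sum (List.map-cong f≗g elems)

  private
    via-∑ᴹ : ∀ {f m} → ∑ᴹ f ≡ m → ∑ f ≡ m
    via-∑ᴹ {f} = trans (∑-∑ᴹ f)

  ∑-+ : (f g : Carrier → ℕ) → ∑ (λ x → f x ℕ.+ g x) ≡ ∑ f ℕ.+ ∑ g
  ∑-+ f g = via-∑ᴹ (trans (∑-distrib-+ (f ∘ at) (g ∘ at)) (sym (cong₂ ℕ._+_ (∑-∑ᴹ f) (∑-∑ᴹ g))))

  ∑-*ˡ : ∀ k (f : Carrier → ℕ) → ∑ (λ x → k ℕ.* f x) ≡ k ℕ.* ∑ f
  ∑-*ˡ k f = via-∑ᴹ (trans (sym (*-distribˡ-sum k (f ∘ at))) (cong (k ℕ.*_) (sym (∑-∑ᴹ f))))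

  ∑-*ʳ : ∀ k (f : Carrier → ℕ) → ∑ (λ x → f x ℕ.* k) ≡ ∑ f ℕ.* k
  ∑-*ʳ k f = trans (∑-cong λ x → ℕ.*-comm (f x) k) (trans (∑-*ˡ k f) (ℕ.*-comm k _))

  ∑-const : ∀ k → ∑ (λ _ → k) ≡ size ℕ.* k
  ∑-const k = via-∑ᴹ (trans (sum-replicate size) (×-≡-* size))
    where
    open import Algebra.Properties.Monoid.Mult ℕ.+-0-monoid renaming (_×_ to _×ᴺ_)
    ×-≡-* : ∀ n → n ×ᴺ k ≡ n ℕ.* k
    ×-≡-* zero    = refl
    ×-≡-* (suc n) = cong (k ℕ.+_) (×-≡-* n)

  ∑-zero : ∀ {f} → (∀ x → f x ≡ 0) → ∑ f ≡ 0
  ∑-zero f≡0 = trans (∑-cong f≡0) (trans (∑-const 0) (ℕ.*-zeroʳ size))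

  ∑-comm′ : (f : Carrier → Carrier → ℕ) → ∑ (λ x → ∑ (f x)) ≡ ∑ (λ y → ∑ (λ x → f x y))
  ∑-comm′ f = begin
    ∑ (λ x → ∑ (f x))                       ≡⟨ ∑-cong (λ x → ∑-∑ᴹ (f x)) ⟩
    ∑ (λ x → ∑ᴹ (f x))                      ≡⟨ ∑-∑ᴹ _ ⟩
    ∑ᴹ (λ x → ∑ᴹ (f x))                     ≡⟨ ∑-comm {size} {size} (λ i j → f (at i) (at j)) ⟩
    ∑ᴹ (λ y → ∑ᴹ (λ x → f x y))             ≡⟨ ∑-∑ᴹ _ ⟨
    ∑ (λ y → ∑ᴹ (λ x → f x y))              ≡⟨ ∑-cong (λ y → ∑-∑ᴹ (λ x → f x y)) ⟨
    ∑ (λ y → ∑ (λ x → f x y))               ∎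
    where open ≡-Reasoning

  ∑-reindex : (f : Carrier → ℕ) (g h : Carrier → Carrier) → (∀ x → g (h x) ≡ x) → (∀ x → h (g x) ≡ x) → ∑ f ≡ ∑ (f ∘ g)
  ∑-reindex f g h gh hg = via-∑ᴹ (trans (∑ᴹ-reindex f g h gh hg) (sym (∑-∑ᴹ _)))

  ∑-single : ∀ (f : Carrier → ℕ) x → (∀ y → y ≢ x → f y ≡ 0) → ∑ f ≡ f x
  ∑-single f x f≡0 = via-∑ᴹ (∑ᴹ-single f x f≡0)

  sum-mono : ∀ {n} {s t : Fin n → ℕ} → (∀ i → s i ℕ.≤ t i) → sum s ℕ.≤ sum t
  sum-mono {zero}  s≤t = z≤n
  sum-mono {suc n} s≤t = ℕ.+-mono-≤ (s≤t zero) (sum-mono (s≤t ∘ suc))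

  ∑-mono : ∀ {f g} → (∀ x → f x ℕ.≤ g x) → ∑ f ℕ.≤ ∑ g
  ∑-mono {f} {g} f≤g = subst₂ ℕ._≤_ (sym (∑-∑ᴹ f)) (sym (∑-∑ᴹ g)) (sum-mono (f≤g ∘ at))

  ∑-strict-mono : ∀ {f g} → (∀ x → f x ℕ.≤ g x) → ∀ x → f x ℕ.< g x → ∑ f ℕ.< ∑ g
  ∑-strict-mono {f} {g} f≤g x fx<gx =
    subst₂ ℕ._<_ (sym (∑-∑ᴹ f)) (sym (∑-∑ᴹ g))
      (sum-strict (f≤g ∘ at) (from x) (subst (λ y → f y ℕ.< g y) (sym (at-from x)) fx<gx))
    where
    sum-strict : ∀ {n} {s t : Fin n → ℕ} → (∀ i → s i ℕ.≤ t i) → ∀ i → s i ℕ.< t i → sum s ℕ.< sum t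
    sum-strict s≤t zero    s<t = ℕ.+-mono-<-≤ s<t (sum-mono (s≤t ∘ suc))
    sum-strict s≤t (suc i) s<t = ℕ.+-mono-≤-< (s≤t zero) (sum-strict (s≤t ∘ suc) i s<t)

  -- A strict inequality at a single point would make the totals strict. This is the device that
  -- turns upper bounds on fibres into exact sizes.
  ∑-squeeze : ∀ {f g} → (∀ x → f x ℕ.≤ g x) → ∑ g ℕ.≤ ∑ f → ∀ x → f x ≡ g x
  ∑-squeeze {f} {g} f≤g ∑g≤∑f x with f x ℕ.≟ g x
  ... | yes fx≡gx = fx≡gx
  ... | no  fx≢gx = ⊥-elim (ℕ.<⇒≱ (∑-strict-mono f≤g x (ℕ.≤∧≢⇒< (f≤g x) fx≢gx)) ∑g≤∑f)

  indicator : Bool → ℕ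
  indicator b = if b then 1 else 0

  infix 10 [_]
  -- The Iverson bracket: the size of a solution set becomes a sum of brackets, and counting
  -- arguments become exchanges of sums.
  [_] : {P : Set} → Dec P → ℕ
  [ d ] = indicator ⌊ d ⌋

  []-yes : {P : Set} (d : Dec P) → P → [ d ] ≡ 1
  []-yes (yes _) p = refl
  []-yes (no ¬p) p = ⊥-elim (¬p p)

  []-no : {P : Set} (d : Dec P) → ¬ P → [ d ] ≡ 0
  []-no (yes p) ¬p = ⊥-elim (¬p p)
  []-no (no _)  ¬p = refl

  []-⇔ : {P Q : Set} (d : Dec P) (e : Dec Q) → (P → Q) → (Q → P) → [ d ] ≡ [ e ]
  []-⇔ d (yes q) f g = []-yes d (g q)
  []-⇔ d (no ¬q) f g = []-no d (¬q ∘ f)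

  ∑-[≡]-* : ∀ x (f : Carrier → ℕ) → ∑ (λ y → [ y ≟ x ] ℕ.* f y) ≡ f x
  ∑-[≡]-* x f = trans (∑-single (λ y → [ y ≟ x ] ℕ.* f y) x λ y y≢x → cong (ℕ._* f y) ([]-no (y ≟ x) y≢x))
                      (trans (cong (ℕ._* f x) ([]-yes (x ≟ x) refl)) (ℕ.*-identityˡ _))

  ∑-[≡] : ∀ x → ∑ (λ y → [ y ≟ x ]) ≡ 1
  ∑-[≡] x = trans (∑-cong λ y → sym (ℕ.*-identityʳ [ y ≟ x ])) (∑-[≡]-* x (λ _ → 1))

  ∑-[≡]′ : ∀ x → ∑ (λ y → [ x ≟ y ]) ≡ 1
  ∑-[≡]′ x = trans (∑-cong λ y → []-⇔ (x ≟ y) (y ≟ x) sym sym) (∑-[≡] x)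

  ∑-fibres : (g : Carrier → Carrier) → ∑ (λ u → ∑ (λ x → [ g x ≟ u ])) ≡ size
  ∑-fibres g = begin
    ∑ (λ u → ∑ (λ x → [ g x ≟ u ]))  ≡⟨ ∑-comm′ (λ u x → [ g x ≟ u ]) ⟩
    ∑ (λ x → ∑ (λ u → [ g x ≟ u ]))  ≡⟨ ∑-cong (λ x → ∑-[≡]′ (g x)) ⟩
    ∑ (λ _ → 1)                      ≡⟨ ∑-const 1 ⟩
    size ℕ.* 1                       ≡⟨ ℕ.*-identityʳ size ⟩
    size                             ∎
    where open ≡-Reasoning

  ∑-bijection : {P Q : Carrier → Set} (P? : ∀ x → Dec (P x)) (Q? : ∀ x → Dec (Q x)) (g h : Carrier → Carrier) →
                (∀ x → P x → Q (g x)) → (∀ y → Q y → P (h y)) →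
                (∀ x → P x → h (g x) ≡ x) → (∀ y → Q y → g (h y) ≡ y) →
                ∑ (λ x → [ P? x ]) ≡ ∑ (λ y → [ Q? y ])
  ∑-bijection {P} {Q} P? Q? g h PQ QP hg gh = begin
    ∑ (λ x → [ P? x ])                                ≡⟨ ∑-cong (λ x → sym (spread [ P? x ] (g x))) ⟩
    ∑ (λ x → ∑ (λ y → [ P? x ] ℕ.* [ g x ≟ y ]))      ≡⟨ ∑-comm′ (λ x y → [ P? x ] ℕ.* [ g x ≟ y ]) ⟩
    ∑ (λ y → ∑ (λ x → [ P? x ] ℕ.* [ g x ≟ y ]))      ≡⟨ ∑-cong (λ y → ∑-cong λ x → swap x y) ⟩
    ∑ (λ y → ∑ (λ x → [ Q? y ] ℕ.* [ h y ≟ x ]))      ≡⟨ ∑-cong (λ y → spread [ Q? y ] (h y)) ⟩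
    ∑ (λ y → [ Q? y ])                                ∎
    where
    open ≡-Reasoning
    spread : ∀ k z → ∑ (λ y → k ℕ.* [ z ≟ y ]) ≡ k
    spread k z = trans (∑-*ˡ k λ y → [ z ≟ y ]) (trans (cong (k ℕ.*_) (∑-[≡]′ z)) (ℕ.*-identityʳ k))
    swap : ∀ x y → [ P? x ] ℕ.* [ g x ≟ y ] ≡ [ Q? y ] ℕ.* [ h y ≟ x ]
    swap x y with P? x | Q? y
    ... | no ¬p | no ¬q = refl
    ... | no ¬p | yes q = sym (trans (ℕ.*-identityˡ _) ([]-no (h y ≟ x) λ eq → ¬p (subst P eq (QP y q))))
    ... | yes p | no ¬q = trans (ℕ.*-identityˡ _) ([]-no (g x ≟ y) λ eq → ¬q (subst Q eq (PQ x p)))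
    ... | yes p | yes q = cong (1 ℕ.*_)
      ([]-⇔ (g x ≟ y) (h y ≟ x) (λ eq → trans (cong h (sym eq)) (hg x p)) (λ eq → trans (cong g (sym eq)) (gh y q)))

-- Powers, roots of polynomials, and the characteristic.

module Powers (F : FiniteField) where

  open FiniteSums F public
  open IntegerSolver commutativeRing public using (solve; con; _:=_; _:+_; _:*_; _:-_; :-_)
  open import Algebra.Properties.Ring ring public using (-0#≈0#)
  import Algebra.Properties.CommutativeSemiring.Exp commutativeSemiring as Exp
  open import Algebra.Properties.Semiring.Mult semiring using (×1-homo-*; ×-homo-1; ×-assoc-*)
    renaming (_×_ to _×ꟳ_)

  ^-Exp : ∀ x n → x ^ n ≡ x Exp.^ n
  ^-Exp x zero    = refl
  ^-Exp x (suc n) = cong (x *_) (^-Exp x n)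

  ^-+ : ∀ x m n → x ^ (m ℕ.+ n) ≡ x ^ m * x ^ n
  ^-+ x m n = trans (^-Exp x (m ℕ.+ n)) (trans (Exp.^-homo-* x m n) (sym (cong₂ _*_ (^-Exp x m) (^-Exp x n))))

  ^-^ : ∀ x m n → (x ^ m) ^ n ≡ x ^ (m ℕ.* n)
  ^-^ x m n = begin
    (x ^ m) ^ n           ≡⟨ ^-Exp (x ^ m) n ⟩
    (x ^ m) Exp.^ n       ≡⟨ cong (Exp._^ n) (^-Exp x m) ⟩
    (x Exp.^ m) Exp.^ n   ≡⟨ Exp.^-assocʳ x m n ⟩
    x Exp.^ (m ℕ.* n)     ≡⟨ ^-Exp x (m ℕ.* n) ⟨
    x ^ (m ℕ.* n)         ∎
    where open ≡-Reasoning

  *-^ : ∀ x y n → (x * y) ^ n ≡ x ^ n * y ^ n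
  *-^ x y n = trans (^-Exp (x * y) n) (trans (Exp.^-distrib-* x y n) (sym (cong₂ _*_ (^-Exp x n) (^-Exp y n))))

  ⁻¹-inverseˡ : ∀ {x} → x ≢ 0# → x ⁻¹ * x ≡ 1#
  ⁻¹-inverseˡ {x} x≢0 = trans (*-comm _ x) (⁻¹-inverse x x≢0)

  *-cancelˡ : ∀ {x y z} → x ≢ 0# → x * y ≡ x * z → y ≡ z
  *-cancelˡ {x} {y} {z} x≢0 xy≡xz = begin
    y               ≡⟨ unit y ⟨
    x ⁻¹ * (x * y)  ≡⟨ cong (x ⁻¹ *_) xy≡xz ⟩
    x ⁻¹ * (x * z)  ≡⟨ unit z ⟩
    z               ∎
    where
    open ≡-Reasoning
    unit : ∀ w → x ⁻¹ * (x * w) ≡ w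
    unit w = trans (sym (*-assoc _ x w)) (trans (cong (_* w) (⁻¹-inverseˡ x≢0)) (*-identityˡ w))

  x*y≡0⇒y≡0 : ∀ {x y} → x ≢ 0# → x * y ≡ 0# → y ≡ 0#
  x*y≡0⇒y≡0 {x} x≢0 xy≡0 = *-cancelˡ x≢0 (trans xy≡0 (sym (zeroʳ x)))

  x*y≢0 : ∀ {x y} → x ≢ 0# → y ≢ 0# → x * y ≢ 0#
  x*y≢0 x≢0 y≢0 xy≡0 = y≢0 (x*y≡0⇒y≡0 x≢0 xy≡0)

  x*y≡0⇒ : ∀ x {y} → x * y ≡ 0# → x ≡ 0# ⊎ y ≡ 0#
  x*y≡0⇒ x xy≡0 with x ≟ 0#
  ... | yes x≡0 = inj₁ x≡0
  ... | no  x≢0 = inj₂ (x*y≡0⇒y≡0 x≢0 xy≡0)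

  x^n≡0⇒x≡0 : ∀ {x} n → x ^ n ≡ 0# → x ≡ 0#
  x^n≡0⇒x≡0     zero    1≡0 = ⊥-elim (0≢1 (sym 1≡0))
  x^n≡0⇒x≡0 {x} (suc n) eq  = [ (λ x≡0 → x≡0) , x^n≡0⇒x≡0 n ]′ (x*y≡0⇒ x eq)

  x-y≡0⇒x≡y : ∀ {x y} → x - y ≡ 0# → x ≡ y
  x-y≡0⇒x≡y {x} {y} eq = begin
    x          ≡⟨ solve 2 (λ x y → x := (x :- y) :+ y) refl x y ⟩
    x - y + y  ≡⟨ cong (_+ y) eq ⟩
    0# + y     ≡⟨ +-identityˡ y ⟩
    y          ∎
    where open ≡-Reasoning

  x≡y⇒x-y≡0 : ∀ {x y} → x ≡ y → x - y ≡ 0#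
  x≡y⇒x-y≡0 {x} refl = -‿inverseʳ x

  -- A polynomial is a function together with a Horner scheme that records its degree. The functions
  -- are matched pointwise, which avoids function extensionality.
  data Monic : ℕ → (Carrier → Carrier) → Set where
    one    : ∀ {f} → (∀ x → f x ≡ 1#) → Monic 0 f
    horner : ∀ {n f g} → Monic n g → ∀ c → (∀ x → f x ≡ x * g x + c) → Monic (suc n) f

  monic-power : ∀ n → Monic n (_^ n)
  monic-power zero    = one λ x → refl
  monic-power (suc n) = horner (monic-power n) 0# λ x → sym (+-identityʳ _)

  -- Synthetic division: if f is x g + c and g is (x - r) k + g(r), then the quotient of f is x k +
  -- g(r), with remainder r g(r) + c, which is f(r).
  quotient : ∀ {n f} → Monic (suc n) f → ∀ r → ∃ λ g → Monic n g × (∀ x → f x ≡ (x - r) * g x + f r)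
  quotient {f = f} (horner {g = g} (one g≡1) c f≡) r = (λ _ → 1#) , one (λ _ → refl) , λ x → begin
    f x                             ≡⟨ f≡ x ⟩
    x * g x + c                     ≡⟨ cong (λ y → x * y + c) (g≡1 x) ⟩
    x * 1# + c                      ≡⟨ solve 3 (λ x r c → x :* con 1ℤ :+ c := (x :- r) :* con 1ℤ :+ (r :* con 1ℤ :+ c)) refl x r c ⟩
    (x - r) * 1# + (r * 1# + c)     ≡⟨ cong (λ y → (x - r) * 1# + (r * y + c)) (g≡1 r) ⟨
    (x - r) * 1# + (r * g r + c)    ≡⟨ cong ((x - r) * 1# +_) (f≡ r) ⟨
    (x - r) * 1# + f r              ∎
    where
    open ≡-Reasoning
  quotient {f = f} (horner {g = g} Mg@(horner _ _ _) c f≡) r with quotient Mg r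
  ... | k , Mk , g≡ = (λ x → x * k x + g r) , horner Mk (g r) (λ _ → refl) , λ x → begin
    f x                                       ≡⟨ f≡ x ⟩
    x * g x + c                               ≡⟨ cong (λ y → x * y + c) (g≡ x) ⟩
    x * ((x - r) * k x + g r) + c             ≡⟨ solve 5 (λ x r kx gr c →
                                                   x :* ((x :- r) :* kx :+ gr) :+ c :=
                                                   (x :- r) :* (x :* kx :+ gr) :+ (r :* gr :+ c)) refl x r (k x) (g r) c ⟩
    (x - r) * (x * k x + g r) + (r * g r + c) ≡⟨ cong ((x - r) * (x * k x + g r) +_) (f≡ r) ⟨
    (x - r) * (x * k x + g r) + f r           ∎
    where open ≡-Reasoning

  monic-roots : ∀ {n f} → Monic n f → ∑ (λ x → [ f x ≟ 0# ]) ℕ.≤ n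
  monic-roots {f = f} (one f≡1) =
    ℕ.≤-reflexive (∑-zero λ x → []-no (f x ≟ 0#) λ fx≡0 → 0≢1 (trans (sym fx≡0) (f≡1 x)))
  monic-roots {suc n} {f} Mf@(horner _ _ _) with any? (λ r → f r ≟ 0#)
  ... | no  no-root = ℕ.≤-trans (ℕ.≤-reflexive (∑-zero λ x → []-no (f x ≟ 0#) λ fx≡0 → no-root (x , fx≡0))) z≤n
  ... | yes (r , fr≡0) with quotient Mf r
  ...   | g , Mg , f≡ = begin
    ∑ (λ x → [ f x ≟ 0# ])                                ≤⟨ ∑-mono root ⟩
    ∑ (λ x → [ x ≟ r ] ℕ.+ [ g x ≟ 0# ])                  ≡⟨ ∑-+ (λ x → [ x ≟ r ]) (λ x → [ g x ≟ 0# ]) ⟩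
    ∑ (λ x → [ x ≟ r ]) ℕ.+ ∑ (λ x → [ g x ≟ 0# ])        ≤⟨ ℕ.+-mono-≤ (ℕ.≤-reflexive (∑-[≡] r)) (monic-roots Mg) ⟩
    suc n                                                 ∎
    where
    open ℕ.≤-Reasoning
    root : ∀ x → [ f x ≟ 0# ] ℕ.≤ [ x ≟ r ] ℕ.+ [ g x ≟ 0# ]
    root x with f x ≟ 0#
    ... | no _     = z≤n
    ... | yes fx≡0 with x*y≡0⇒ (x - r) (trans (sym (+-identityʳ _)) (trans (cong (_ +_) (sym fr≡0)) (trans (sym (f≡ x)) fx≡0)))
    ...   | inj₁ x-r≡0 = ℕ.≤-trans (ℕ.≤-reflexive (sym ([]-yes (x ≟ r) (x-y≡0⇒x≡y x-r≡0)))) (ℕ.m≤m+n _ _)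
    ...   | inj₂ gx≡0  = ℕ.≤-trans (ℕ.≤-reflexive (sym ([]-yes (g x ≟ 0#) gx≡0))) (ℕ.m≤n+m _ _)

  size≢0 : size ≢ 0
  size≢0 eq with subst Fin eq (from 0#)
  ... | ()

  -- Multiplication by x permutes the non-zero elements, so x times their product is x ^ size times it.
  x^size≡x : ∀ x → x ^ size ≡ x
  x^size≡x x with x ≟ 0#
  ... | yes refl with size | size≢0
  ...   | zero  | nz = ⊥-elim (nz refl)
  ...   | suc n | _  = zeroˡ _
  x^size≡x x | no x≢0 = *-cancelˡ P≢0 (begin
    P * x ^ size              ≡⟨ *-comm P _ ⟩
    x ^ size * P              ≡⟨ cong (_* P) (trans (^-Exp x size) (sym (sum-replicate size))) ⟩
    ∏ (λ _ → x) * P           ≡⟨ ∑-distrib-+ (λ _ → x) (nz ∘ at) ⟨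
    ∏ (λ y → x * nz y)        ≡⟨ sum-cong-≗ (λ i → pointwise (at i)) ⟩
    ∏ (λ y → k y * nz (x * y)) ≡⟨ ∑-distrib-+ (k ∘ at) (λ i → nz (x * at i)) ⟩
    ∏ k * ∏ (nz ∘ (x *_))     ≡⟨ cong₂ _*_ ∏k≡x (sym (∑ᴹ-reindex nz (x *_) (x ⁻¹ *_) (cancel (⁻¹-inverse x x≢0)) (cancel (⁻¹-inverseˡ x≢0)))) ⟩
    x * P                     ≡⟨ *-comm x P ⟩
    P * x                     ∎)
    where
    open ≡-Reasoning
    open CarrierSum *-commutativeMonoid renaming (∑ᴹ to ∏)
    open import Algebra.Properties.CommutativeMonoid.Sum *-commutativeMonoid
      using (sum; sum-replicate; ∑-distrib-+; sum-cong-≗)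
    nz k : Carrier → Carrier
    nz y = if ⌊ y ≟ 0# ⌋ then 1# else y
    k  y = if ⌊ y ≟ 0# ⌋ then x else 1#
    P : Carrier
    P = ∏ nz
    nz≢0 : ∀ y → nz y ≢ 0#
    nz≢0 y with y ≟ 0#
    ... | yes _  = 0≢1 ∘ sym
    ... | no y≢0 = y≢0
    product≢0 : ∀ {n} (t : Fin n → Carrier) → (∀ i → t i ≢ 0#) → sum t ≢ 0#
    product≢0 {zero}  t t≢0 = 0≢1 ∘ sym
    product≢0 {suc n} t t≢0 = x*y≢0 (t≢0 zero) (product≢0 (t ∘ suc) (t≢0 ∘ suc))
    P≢0 : P ≢ 0#
    P≢0 = product≢0 (nz ∘ at) (nz≢0 ∘ at)
    cancel : ∀ {u v} → u * v ≡ 1# → ∀ y → u * (v * y) ≡ y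
    cancel uv≡1 y = trans (sym (*-assoc _ _ y)) (trans (cong (_* y) uv≡1) (*-identityˡ y))
    pointwise : ∀ y → x * nz y ≡ k y * nz (x * y)
    pointwise y with y ≟ 0# | (x * y) ≟ 0#
    ... | yes _   | yes _    = refl
    ... | yes y≡0 | no xy≢0  = ⊥-elim (xy≢0 (trans (cong (x *_) y≡0) (zeroʳ x)))
    ... | no y≢0  | yes xy≡0 = ⊥-elim (x*y≢0 x≢0 y≢0 xy≡0)
    ... | no _    | no _     = sym (*-identityˡ _)
    k0≡x : k 0# ≡ x
    k0≡x with 0# ≟ 0#
    ... | yes _  = refl
    ... | no 0≢0 = ⊥-elim (0≢0 refl)
    ∏k≡x : ∏ k ≡ x
    ∏k≡x = trans (∑ᴹ-single k 0# k≡1) k0≡x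
      where
      k≡1 : ∀ y → y ≢ 0# → k y ≡ 1#
      k≡1 y y≢0 with y ≟ 0#
      ... | yes y≡0 = ⊥-elim (y≢0 y≡0)
      ... | no _    = refl

  -- Translation by `1#` permutes the field, so the sum `S` of all elements equals `S` plus `size`
  -- copies of `1#`.
  size×1≡0 : size ×ꟳ 1# ≡ 0#
  size×1≡0 = begin
    size ×ꟳ 1#                ≡⟨ solve 2 (λ s t → t := (s :+ t) :- s) refl S (size ×ꟳ 1#) ⟩
    S + size ×ꟳ 1# - S        ≡⟨ cong (_- S) shifted ⟨
    S - S                     ≡⟨ -‿inverseʳ S ⟩
    0#                        ∎
    where
    open ≡-Reasoning
    open CarrierSum +-commutativeMonoid renaming (∑ᴹ to ∑ꟳ)
    open import Algebra.Properties.CommutativeMonoid.Sum +-commutativeMonoid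
      using (sum-replicate; ∑-distrib-+)
    S : Carrier
    S = ∑ꟳ (λ y → y)
    shifted : S ≡ S + size ×ꟳ 1#
    shifted = begin
      ∑ꟳ (λ y → y)             ≡⟨ ∑ᴹ-reindex (λ y → y) (_+ 1#) (_- 1#)
                                     (λ y → solve 2 (λ y e → (y :- e) :+ e := y) refl y 1#)
                                     (λ y → solve 2 (λ y e → (y :+ e) :- e := y) refl y 1#) ⟩
      ∑ꟳ (λ y → y + 1#)        ≡⟨ ∑-distrib-+ at (λ _ → 1#) ⟩
      S + ∑ꟳ (λ _ → 1#)        ≡⟨ cong (S +_) (sum-replicate size) ⟩
      S + size ×ꟳ 1#           ∎

  CharacteristicDivides : ℕ → Set
  CharacteristicDivides n = n ×ꟳ 1# ≡ 0#

  characteristic-2 : CharacteristicDivides 2 → 1# + 1# ≡ 0#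
  characteristic-2 = trans (cong (1# +_) (sym (+-identityʳ 1#)))

  -- The n-th power of the field element p · 1 is the image of `size`, hence zero, and a field has
  -- no zero divisors.
  prime-power-characteristic : ∀ p n → size ≡ p ℕ.^ n → CharacteristicDivides p
  prime-power-characteristic p n size≡ = go n (trans (cong (_×ꟳ 1#) (sym size≡)) size×1≡0)
    where
    go : ∀ n → (p ℕ.^ n) ×ꟳ 1# ≡ 0# → p ×ꟳ 1# ≡ 0#
    go zero    eq = ⊥-elim (0≢1 (trans (sym eq) (+-identityʳ 1#)))
    go (suc n) eq = [ (λ p≡0 → p≡0) , go n ]′ (x*y≡0⇒ (p ×ꟳ 1#) (trans (sym (×1-homo-* p (p ℕ.^ n))) eq))

  -- If two vanishes, an odd multiple of `1#` is `1#`, whereas the multiple by `size` is zero. This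
  -- is how characteristic 2 is excluded when q is odd.
  1+1≡0⇒2∣size : 1# + 1# ≡ 0# → 2 ∣ size
  1+1≡0⇒2∣size 1+1≡0 = [ (λ 2∣size → 2∣size) , (λ size×1≡1 → ⊥-elim (0≢1 (trans (sym size×1≡0) size×1≡1))) ]′ (parity size)
    where
    open ≡-Reasoning
    parity : ∀ n → 2 ∣ n ⊎ n ×ꟳ 1# ≡ 1#
    parity zero          = inj₁ (divides 0 refl)
    parity (suc zero)    = inj₂ (+-identityʳ 1#)
    parity (suc (suc n)) with parity n
    ... | inj₁ (divides k n≡k*2) = inj₁ (divides (suc k) (cong (2 ℕ.+_) n≡k*2))
    ... | inj₂ n×1≡1 = inj₂ (begin
      1# + (1# + n ×ꟳ 1#)   ≡⟨ +-assoc 1# 1# _ ⟨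
      1# + 1# + n ×ꟳ 1#     ≡⟨ cong₂ _+_ 1+1≡0 n×1≡1 ⟩
      0# + 1#               ≡⟨ +-identityˡ 1# ⟩
      1#                    ∎)

  private
    ×-∣ : ∀ {p n} → p ×ꟳ 1# ≡ 0# → p ∣ n → ∀ x → n ×ꟳ x ≡ 0#
    ×-∣ {p} p×1≡0 (divides k refl) x = begin
      (k ℕ.* p) ×ꟳ x                ≡⟨ cong ((k ℕ.* p) ×ꟳ_) (*-identityˡ x) ⟨
      (k ℕ.* p) ×ꟳ (1# * x)         ≡⟨ ×-assoc-* (k ℕ.* p) 1# x ⟨
      (k ℕ.* p) ×ꟳ 1# * x           ≡⟨ cong (_* x) (×1-homo-* k p) ⟩
      (k ×ꟳ 1#) * (p ×ꟳ 1#) * x     ≡⟨ cong (λ y → (k ×ꟳ 1#) * y * x) p×1≡0 ⟩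
      (k ×ꟳ 1#) * 0# * x            ≡⟨ cong (_* x) (zeroʳ _) ⟩
      0# * x                        ≡⟨ zeroˡ x ⟩
      0#                            ∎
      where open ≡-Reasoning

  +-^-prime : ∀ {p} → Prime p → CharacteristicDivides p → ∀ x y → (x + y) ^ p ≡ x ^ p + y ^ p
  +-^-prime {zero}      pp = ⊥-elim (¬prime[0] pp)
  +-^-prime {p@(suc n)} pp p×1≡0 x y = begin
    (x + y) ^ p                                     ≡⟨ ^-Exp (x + y) p ⟩
    (x + y) Exp.^ p                                 ≡⟨ theorem p x y ⟩
    term zero + ∑[ k < p ] term (suc k)             ≡⟨ cong₂ _+_ first (sum-init-last (term ∘ suc)) ⟩
    y ^ p + (∑[ k < n ] term (suc (inject₁ k)) + term (fromℕ p))
                                                    ≡⟨ cong₂ (λ u v → y ^ p + (u + v)) middle last ⟩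
    y ^ p + (0# + x ^ p)                            ≡⟨ cong (y ^ p +_) (+-identityˡ _) ⟩
    y ^ p + x ^ p                                   ≡⟨ +-comm _ _ ⟩
    x ^ p + y ^ p                                   ∎
    where
    open ≡-Reasoning
    open import Algebra.Properties.CommutativeSemiring.Binomial commutativeSemiring using (theorem; binomialTerm)
    open import Algebra.Properties.Semiring.Sum semiring using (sum-syntax; sum-init-last; sum-cong-≗; sum-replicate-zero)
    term : Fin (suc p) → Carrier
    term = binomialTerm x y p
    first : term zero ≡ y ^ p
    first = trans (×-homo-1 _) (trans (*-identityˡ _) (sym (^-Exp y p)))
    last : term (fromℕ p) ≡ x ^ p
    last = begin
      term (fromℕ p)                                ≡⟨ cong (λ k → (p C k) ×ꟳ (x Exp.^ k * y Exp.^ (p ℕ.∸ k))) (Fin.toℕ-fromℕ p) ⟩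
      (p C p) ×ꟳ (x Exp.^ p * y Exp.^ (p ℕ.∸ p))    ≡⟨ cong₂ (λ c e → c ×ꟳ (x Exp.^ p * y Exp.^ e)) (nCn≡1 p) (ℕ.n∸n≡0 p) ⟩
      1 ×ꟳ (x Exp.^ p * 1#)                         ≡⟨ ×-homo-1 _ ⟩
      x Exp.^ p * 1#                                ≡⟨ *-identityʳ _ ⟩
      x Exp.^ p                                     ≡⟨ ^-Exp x p ⟨
      x ^ p                                         ∎
    middle : ∑[ k < n ] term (suc (inject₁ k)) ≡ 0#
    middle = trans (sum-cong-≗ λ k → ×-∣ p×1≡0 (prime∣C pp (suc (toℕ (inject₁ k))) (s≤s z≤n)
                     (s≤s (subst (ℕ._< n) (sym (Fin.toℕ-inject₁ k)) (Fin.toℕ<n k)))) _)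
                   (sum-replicate-zero n)

  +-^-prime-power : ∀ {p} → Prime p → CharacteristicDivides p → ∀ h x y → (x + y) ^ (p ℕ.^ h) ≡ x ^ (p ℕ.^ h) + y ^ (p ℕ.^ h)
  +-^-prime-power pp p×1≡0 zero    x y = trans (*-identityʳ _) (sym (cong₂ _+_ (*-identityʳ x) (*-identityʳ y)))
  +-^-prime-power {p} pp p×1≡0 (suc h) x y = begin
    (x + y) ^ (p ℕ.* p ℕ.^ h)                   ≡⟨ ^-^ (x + y) p (p ℕ.^ h) ⟨
    ((x + y) ^ p) ^ (p ℕ.^ h)                   ≡⟨ cong (_^ (p ℕ.^ h)) (+-^-prime pp p×1≡0 x y) ⟩
    (x ^ p + y ^ p) ^ (p ℕ.^ h)                 ≡⟨ +-^-prime-power pp p×1≡0 h (x ^ p) (y ^ p) ⟩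
    (x ^ p) ^ (p ℕ.^ h) + (y ^ p) ^ (p ℕ.^ h)   ≡⟨ cong₂ _+_ (^-^ x p (p ℕ.^ h)) (^-^ y p (p ℕ.^ h)) ⟩
    x ^ (p ℕ.* p ℕ.^ h) + y ^ (p ℕ.* p ℕ.^ h)   ∎
    where open ≡-Reasoning

-- Sums over affine points and linear equations.

module PointSums (F : FiniteField) where

  open Powers F public

  -- Recurses like `count` but admits weights, so that the contribution of one coordinate can be
  -- summed first and carried as a factor.
  ∑ᴾ : ∀ m → (Point m → ℕ) → ℕ
  ∑ᴾ zero    g = g (λ ())
  ∑ᴾ (suc m) g = ∑ (λ x → ∑ᴾ m (λ w → g (cons x w)))

  count-∑ᴾ : ∀ m (S : PointSet m) → count m S ≡ ∑ᴾ m (indicator ∘ S)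
  count-∑ᴾ zero    S = refl
  count-∑ᴾ (suc m) S = ∑-cong λ x → count-∑ᴾ m (S ∘ cons x)

  ∑ᴾ-cong : ∀ m {g h : Point m → ℕ} → g ≗ h → ∑ᴾ m g ≡ ∑ᴾ m h
  ∑ᴾ-cong zero    g≗h = g≗h _
  ∑ᴾ-cong (suc m) g≗h = ∑-cong λ x → ∑ᴾ-cong m (g≗h ∘ cons x)

  ∑ᴾ-const : ∀ m k → ∑ᴾ m (λ _ → k) ≡ size ℕ.^ m ℕ.* k
  ∑ᴾ-const zero    k = sym (ℕ.*-identityˡ k)
  ∑ᴾ-const (suc m) k = trans (∑-cong λ _ → ∑ᴾ-const m k) (trans (∑-const _) (sym (ℕ.*-assoc size _ k)))

  ∑ᴾ-*ʳ : ∀ m (g : Point m → ℕ) k → ∑ᴾ m (λ w → g w ℕ.* k) ≡ ∑ᴾ m g ℕ.* k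
  ∑ᴾ-*ʳ zero    g k = refl
  ∑ᴾ-*ʳ (suc m) g k = trans (∑-cong λ x → ∑ᴾ-*ʳ m (g ∘ cons x) k) (∑-*ʳ k (λ x → ∑ᴾ m (g ∘ cons x)))

  ∑ᴾ-mono : ∀ m {g h : Point m → ℕ} → (∀ w → g w ℕ.≤ h w) → ∑ᴾ m g ℕ.≤ ∑ᴾ m h
  ∑ᴾ-mono zero    g≤h = g≤h _
  ∑ᴾ-mono (suc m) g≤h = ∑-mono λ x → ∑ᴾ-mono m (g≤h ∘ cons x)

  cons-head-tail : ∀ {m} (w : Point (suc m)) → cons (w zero) (w ∘ suc) ≗ w
  cons-head-tail w zero    = refl
  cons-head-tail w (suc i) = refl

  cons-cong : ∀ {m} x {w w′ : Point m} → w ≗ w′ → cons x w ≗ cons x w′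
  cons-cong x w≗w′ zero    = refl
  cons-cong x w≗w′ (suc i) = w≗w′ i

  -- Strictness is demanded for every point that agrees with `w` coordinatewise, because the sum
  -- visits points rebuilt by `cons`, and these equal `w` only pointwise.
  ∑ᴾ-strict-mono : ∀ m {g h : Point m → ℕ} → (∀ w → g w ℕ.≤ h w) →
                   ∀ w → (∀ {w′} → w′ ≗ w → g w′ ℕ.< h w′) → ∑ᴾ m g ℕ.< ∑ᴾ m h
  ∑ᴾ-strict-mono zero    g≤h w g<h = g<h λ ()
  ∑ᴾ-strict-mono (suc m) g≤h w g<h = ∑-strict-mono (λ x → ∑ᴾ-mono m (g≤h ∘ cons x)) (w zero)
    (∑ᴾ-strict-mono m (g≤h ∘ cons (w zero)) (w ∘ suc) λ w′≗ → g<h λ i →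
      trans (cons-cong (w zero) w′≗ i) (cons-head-tail w i))

  ∑-∑ᴾ-comm : ∀ m (g : Carrier → Point m → ℕ) → ∑ (λ x → ∑ᴾ m (g x)) ≡ ∑ᴾ m (λ w → ∑ (λ x → g x w))
  ∑-∑ᴾ-comm zero    g = refl
  ∑-∑ᴾ-comm (suc m) g = trans (∑-comm′ (λ x y → ∑ᴾ m (g x ∘ cons y)))
                              (∑-cong λ y → ∑-∑ᴾ-comm m (λ x → g x ∘ cons y))

  snoc : ∀ {m} → Point m → Carrier → Point (suc m)
  snoc {zero}  w y _       = y
  snoc {suc m} w y zero    = w zero
  snoc {suc m} w y (suc i) = snoc (w ∘ suc) y i

  snoc-inject₁ : ∀ {m} (w : Point m) y → snoc w y ∘ inject₁ ≗ w
  snoc-inject₁ w y zero    = refl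
  snoc-inject₁ w y (suc i) = snoc-inject₁ (w ∘ suc) y i

  snoc-fromℕ : ∀ {m} (w : Point m) y → snoc w y (fromℕ m) ≡ y
  snoc-fromℕ {zero}  w y = refl
  snoc-fromℕ {suc m} w y = snoc-fromℕ (w ∘ suc) y

  -- The recursion peels off the first coordinate, whereas the equation of B(a,b) singles out the
  -- last one.
  ∑ᴾ-snoc : ∀ m (g : Point (suc m) → ℕ) → (∀ {w w′} → w ≗ w′ → g w ≡ g w′) →
            ∑ᴾ (suc m) g ≡ ∑ᴾ m (λ w → ∑ (λ y → g (snoc w y)))
  ∑ᴾ-snoc zero    g g-cong = ∑-cong λ x → g-cong λ { zero → refl }
  ∑ᴾ-snoc (suc m) g g-cong = ∑-cong λ x → trans
    (∑ᴾ-snoc m (g ∘ cons x) (g-cong ∘ cons-cong x))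
    (∑ᴾ-cong m λ w → ∑-cong λ y → g-cong λ { zero → refl ; (suc i) → refl })

  sumFin-cong : ∀ m {t t′ : Fin m → Carrier} → t ≗ t′ → sumFin m t ≡ sumFin m t′
  sumFin-cong zero    t≗t′ = refl
  sumFin-cong (suc m) t≗t′ = cong₂ _+_ (t≗t′ zero) (sumFin-cong m (t≗t′ ∘ suc))

  sumFin-snoc : ∀ m (t : Fin (suc m) → Carrier) → sumFin (suc m) t ≡ sumFin m (t ∘ inject₁) + t (fromℕ m)
  sumFin-snoc zero    t = +-comm _ _
  sumFin-snoc (suc m) t = trans (cong (t zero +_) (sumFin-snoc m (t ∘ suc))) (sym (+-assoc _ _ _))

  sumFin-+ : ∀ m (t s : Fin m → Carrier) → sumFin m (λ i → t i + s i) ≡ sumFin m t + sumFin m s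
  sumFin-+ zero    t s = sym (+-identityˡ 0#)
  sumFin-+ (suc m) t s = trans (cong (t zero + s zero +_) (sumFin-+ m (t ∘ suc) (s ∘ suc)))
    (solve 4 (λ a b c d → (a :+ b) :+ (c :+ d) := (a :+ c) :+ (b :+ d)) refl (t zero) (s zero) _ _)

  sumFin-*ˡ : ∀ m c (t : Fin m → Carrier) → sumFin m (λ i → c * t i) ≡ c * sumFin m t
  sumFin-*ˡ zero    c t = sym (zeroʳ c)
  sumFin-*ˡ (suc m) c t = trans (cong (c * t zero +_) (sumFin-*ˡ m c (t ∘ suc))) (sym (distribˡ c _ _))

  sumFin-neg : ∀ m (t : Fin m → Carrier) → sumFin m (λ i → - t i) ≡ - sumFin m t
  sumFin-neg zero    t = sym -0#≈0#
  sumFin-neg (suc m) t = trans (cong (- t zero +_) (sumFin-neg m (t ∘ suc)))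
    (solve 2 (λ a b → (:- a) :+ (:- b) := :- (a :+ b)) refl (t zero) _)

  sumFin-- : ∀ m (t s : Fin m → Carrier) → sumFin m (λ i → t i - s i) ≡ sumFin m t - sumFin m s
  sumFin-- m t s = trans (sumFin-+ m t (-_ ∘ s)) (cong (sumFin m t +_) (sumFin-neg m s))

  linear-equation : ∀ {c} → c ≢ 0# → ∀ e d x → c * x + e ≡ d → x ≡ c ⁻¹ * (d - e)
  linear-equation {c} c≢0 e d x eq = *-cancelˡ c≢0 (begin
    c * x                   ≡⟨ solve 2 (λ u e → u := (u :+ e) :- e) refl (c * x) e ⟩
    c * x + e - e           ≡⟨ cong (_- e) eq ⟩
    d - e                   ≡⟨ *-identityˡ _ ⟨
    1# * (d - e)            ≡⟨ cong (_* (d - e)) (⁻¹-inverse c c≢0) ⟨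
    c * c ⁻¹ * (d - e)      ≡⟨ *-assoc _ _ _ ⟩
    c * (c ⁻¹ * (d - e))    ∎)
    where open ≡-Reasoning

  linear-equation⁻¹ : ∀ {c} → c ≢ 0# → ∀ e d → c * (c ⁻¹ * (d - e)) + e ≡ d
  linear-equation⁻¹ {c} c≢0 e d = begin
    c * (c ⁻¹ * (d - e)) + e    ≡⟨ cong (_+ e) (*-assoc _ _ _) ⟨
    c * c ⁻¹ * (d - e) + e      ≡⟨ cong (λ u → u * (d - e) + e) (⁻¹-inverse c c≢0) ⟩
    1# * (d - e) + e            ≡⟨ cong (_+ e) (*-identityˡ _) ⟩
    d - e + e                   ≡⟨ solve 2 (λ d e → (d :- e) :+ e := d) refl d e ⟩
    d                           ∎
    where open ≡-Reasoning

  -- Once the other coordinates are chosen, the one with non-zero coefficient is determined. The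
  -- induction moves along the coordinates until that one comes first.
  linear-solutions : ∀ m (c : Point (suc m)) i → c i ≢ 0# → ∀ d →
                     ∑ᴾ (suc m) (λ w → [ sumFin (suc m) (λ j → c j * w j) ≟ d ]) ≡ size ℕ.^ m
  linear-solutions m c zero c₀≢0 d = begin
    ∑ (λ x → ∑ᴾ m (λ w → [ (c zero * x + e w) ≟ d ]))   ≡⟨ ∑-∑ᴾ-comm m (λ x w → [ (c zero * x + e w) ≟ d ]) ⟩
    ∑ᴾ m (λ w → ∑ (λ x → [ (c zero * x + e w) ≟ d ]))   ≡⟨ ∑ᴾ-cong m (λ w → trans (∑-cong λ x → unique w x) (∑-[≡] (c zero ⁻¹ * (d - e w)))) ⟩
    ∑ᴾ m (λ w → 1)                                      ≡⟨ ∑ᴾ-const m 1 ⟩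
    size ℕ.^ m ℕ.* 1                                    ≡⟨ ℕ.*-identityʳ _ ⟩
    size ℕ.^ m                                          ∎
    where
    open ≡-Reasoning
    e : Point m → Carrier
    e w = sumFin m (λ j → c (suc j) * w j)
    unique : ∀ w x → [ (c zero * x + e w) ≟ d ] ≡ [ x ≟ (c zero ⁻¹ * (d - e w)) ]
    unique w x = []-⇔ ((c zero * x + e w) ≟ d) (x ≟ (c zero ⁻¹ * (d - e w))) (linear-equation c₀≢0 (e w) d x)
      λ x≡ → trans (cong (λ y → c zero * y + e w) x≡) (linear-equation⁻¹ c₀≢0 (e w) d)
  linear-solutions (suc m) c (suc i) cᵢ≢0 d = trans
    (∑-cong λ x → trans (∑ᴾ-cong (suc m) (shift x)) (linear-solutions m (c ∘ suc) i cᵢ≢0 (d - c zero * x)))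
    (∑-const _)
    where
    e : Point (suc m) → Carrier
    e w = sumFin (suc m) (λ j → c (suc j) * w j)
    shift : ∀ x w → [ (c zero * x + e w) ≟ d ] ≡ [ e w ≟ (d - c zero * x) ]
    shift x w = []-⇔ ((c zero * x + e w) ≟ d) (e w ≟ (d - c zero * x))
      (λ eq → trans (solve 2 (λ u e → e := (u :+ e) :- u) refl (c zero * x) (e w)) (cong (_- c zero * x) eq))
      (λ eq → trans (cong (c zero * x +_) eq) (solve 2 (λ u d → u :+ (d :- u) := d) refl (c zero * x) d))

-- Conjugation over GF(q) and linear maps of norm one.

-- The interface between the prime power and the geometry: additivity of the q-th power stands in
-- for the prime.
record SquareOrder (F : FiniteField) (q : ℕ) : Set where
  open PointSums F
  field
    2≤q       : 2 ℕ.≤ q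
    size≡q*q  : size ≡ q ℕ.* q
    +-^q      : ∀ x y → (x + y) ^ q ≡ x ^ q + y ^ q

module Conjugation (F : FiniteField) (q : ℕ) (order : SquareOrder F q) where

  open PointSums F
  open SquareOrder order

  private
    instance
      q-nonZero : ℕ.NonZero q
      q-nonZero = ℕ.>-nonZero (ℕ.≤-trans (s≤s z≤n) 2≤q)

  σ : Carrier → Carrier
  σ x = x ^ q

  σ-+ : ∀ x y → σ (x + y) ≡ σ x + σ y
  σ-+ = +-^q

  σ-* : ∀ x y → σ (x * y) ≡ σ x * σ y
  σ-* x y = *-^ x y q

  σ-σ : ∀ x → σ (σ x) ≡ x
  σ-σ x = trans (^-^ x q q) (trans (cong (x ^_) (sym size≡q*q)) (x^size≡x x))

  σ-0 : σ 0# ≡ 0#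
  σ-0 = begin
    σ 0#                  ≡⟨ solve 1 (λ s → s := (s :+ s) :- s) refl (σ 0#) ⟩
    σ 0# + σ 0# - σ 0#    ≡⟨ cong (_- σ 0#) (σ-+ 0# 0#) ⟨
    σ (0# + 0#) - σ 0#    ≡⟨ cong (λ x → σ x - σ 0#) (+-identityˡ 0#) ⟩
    σ 0# - σ 0#           ≡⟨ -‿inverseʳ (σ 0#) ⟩
    0#                    ∎
    where open ≡-Reasoning

  σ-‿- : ∀ x → σ (- x) ≡ - σ x
  σ-‿- x = begin
    σ (- x)               ≡⟨ solve 2 (λ s t → t := (t :+ s) :- s) refl (σ x) (σ (- x)) ⟩
    σ (- x) + σ x - σ x   ≡⟨ cong (_- σ x) (σ-+ (- x) x) ⟨
    σ (- x + x) - σ x     ≡⟨ cong (λ y → σ y - σ x) (-‿inverseˡ x) ⟩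
    σ 0# - σ x            ≡⟨ cong (_- σ x) σ-0 ⟩
    0# - σ x              ≡⟨ +-identityˡ _ ⟩
    - σ x                 ∎
    where open ≡-Reasoning

  σ-- : ∀ x y → σ (x - y) ≡ σ x - σ y
  σ-- x y = trans (σ-+ x (- y)) (cong (σ x +_) (σ-‿- y))

  σ-≢0 : ∀ {x} → x ≢ 0# → σ x ≢ 0#
  σ-≢0 x≢0 σx≡0 = x≢0 (x^n≡0⇒x≡0 q σx≡0)

  linear-roots≤q : ∀ y u → ∑ (λ x → [ (σ x - y * x) ≟ u ]) ℕ.≤ q
  linear-roots≤q y u = ℕ.≤-trans
    (ℕ.≤-reflexive (∑-cong λ x → []-⇔ ((σ x - y * x) ≟ u) ((σ x - y * x - u) ≟ 0#) x≡y⇒x-y≡0 x-y≡0⇒x≡y))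
    (monic-roots (monic q 2≤q))
    where
    -- The bound on n keeps the term `y * x` below the leading one; at n = 1 it would change the
    -- leading coefficient.
    monic : ∀ n → 2 ℕ.≤ n → Monic n (λ x → x ^ n - y * x - u)
    monic (suc (suc n)) _ = horner (horner (monic-power n) (- y) (λ x → refl)) (- u)
      λ x → cong (_- u) (solve 3 (λ x w y → x :* w :- y :* x := x :* (w :+ (:- y))) refl x (x ^ suc n) y)
    monic 1 (s≤s ())

  module _ {y} (norm : σ y * y ≡ 1#) where

    -- Norm 1 allows x to be written as `σ y * y * x`, after which `- σ y` factors out of the
    -- conjugate. Thus the image lies in the zero set of a map of the same kind.
    σ-linear : ∀ x → σ (σ x - y * x) ≡ - σ y * (σ x - y * x)
    σ-linear x = begin
      σ (σ x - y * x)                     ≡⟨ σ-- (σ x) (y * x) ⟩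
      σ (σ x) - σ (y * x)                 ≡⟨ cong₂ _-_ (σ-σ x) (σ-* y x) ⟩
      x - σ y * σ x                       ≡⟨ cong (_- σ y * σ x) (*-identityˡ x) ⟨
      1# * x - σ y * σ x                  ≡⟨ cong (λ e → e * x - σ y * σ x) norm ⟨
      σ y * y * x - σ y * σ x             ≡⟨ solve 4 (λ y sy x sx → sy :* y :* x :- sy :* sx := (:- sy) :* (sx :- y :* x)) refl y (σ y) x (σ x) ⟩
      - σ y * (σ x - y * x)               ∎
      where open ≡-Reasoning

    -- All q² points lie in the at most q fibres over the kernel of u ↦ σ u + σ y * u,
    -- and each fibre has at most q points, so both bounds are attained.
    linear-fibre : ∀ u → ∑ (λ x → [ (σ x - y * x) ≟ u ]) ≡ q ℕ.* [ σ u ≟ (- σ y * u) ]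
    linear-fibre = ∑-squeeze pointwise total
      where
      open ℕ.≤-Reasoning
      pointwise : ∀ u → ∑ (λ x → [ (σ x - y * x) ≟ u ]) ℕ.≤ q ℕ.* [ σ u ≟ (- σ y * u) ]
      pointwise u with σ u ≟ (- σ y * u)
      ... | yes _ = ℕ.≤-trans (linear-roots≤q y u) (ℕ.≤-reflexive (sym (ℕ.*-identityʳ q)))
      ... | no ¬p = ℕ.≤-trans (ℕ.≤-reflexive (∑-zero λ x → []-no ((σ x - y * x) ≟ u)
                      λ eq → ¬p (subst (λ v → σ v ≡ - σ y * v) eq (σ-linear x)))) z≤n
      total : ∑ (λ u → q ℕ.* [ σ u ≟ (- σ y * u) ]) ℕ.≤ ∑ (λ u → ∑ (λ x → [ (σ x - y * x) ≟ u ]))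
      total = begin
        ∑ (λ u → q ℕ.* [ σ u ≟ (- σ y * u) ])           ≡⟨ ∑-*ˡ q (λ u → [ σ u ≟ (- σ y * u) ]) ⟩
        q ℕ.* ∑ (λ u → [ σ u ≟ (- σ y * u) ])           ≡⟨ cong (q ℕ.*_) (∑-cong λ u →
                                                             []-⇔ (σ u ≟ (- σ y * u)) ((σ u - - σ y * u) ≟ 0#) x≡y⇒x-y≡0 x-y≡0⇒x≡y) ⟩
        q ℕ.* ∑ (λ u → [ (σ u - - σ y * u) ≟ 0# ])      ≤⟨ ℕ.*-monoʳ-≤ q (linear-roots≤q (- σ y) 0#) ⟩
        q ℕ.* q                                         ≡⟨ trans (∑-fibres (λ x → σ x - y * x)) size≡q*q ⟨
        ∑ (λ u → ∑ (λ x → [ (σ x - y * x) ≟ u ]))       ∎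

    linear-kernel : ∑ (λ x → [ σ x ≟ (y * x) ]) ≡ q
    linear-kernel = begin
      ∑ (λ x → [ σ x ≟ (y * x) ])             ≡⟨ ∑-cong (λ x → []-⇔ (σ x ≟ (y * x)) ((σ x - y * x) ≟ 0#) x≡y⇒x-y≡0 x-y≡0⇒x≡y) ⟩
      ∑ (λ x → [ (σ x - y * x) ≟ 0# ])        ≡⟨ linear-fibre 0# ⟩
      q ℕ.* [ σ 0# ≟ (- σ y * 0#) ]           ≡⟨ cong (q ℕ.*_) ([]-yes (σ 0# ≟ (- σ y * 0#)) (trans σ-0 (sym (zeroʳ _)))) ⟩
      q ℕ.* 1                                 ≡⟨ ℕ.*-identityʳ q ⟩
      q                                       ∎
      where open ≡-Reasoning

    -- Makes the kernel count applicable to the set that contains the image, where `- σ y` takes the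
    -- place of `y`.
    norm-conjugate : σ (- σ y) * - σ y ≡ 1#
    norm-conjugate = begin
      σ (- σ y) * - σ y     ≡⟨ cong (_* - σ y) (trans (σ-‿- (σ y)) (cong (-_) (σ-σ y))) ⟩
      - y * - σ y           ≡⟨ solve 2 (λ y s → (:- y) :* (:- s) := s :* y) refl y (σ y) ⟩
      σ y * y               ≡⟨ norm ⟩
      1#                    ∎
      where open ≡-Reasoning

    linear-kernel∖0 : {Q : Carrier → Set} (Q? : ∀ u → Dec (Q u)) →
                      (∀ {u} → Q u → u ≢ 0# × σ u ≡ y * u) → (∀ {u} → u ≢ 0# → σ u ≡ y * u → Q u) →
                      ∑ (λ u → [ Q? u ]) ≡ q ℕ.∸ 1
    linear-kernel∖0 {Q} Q? Q⇒ ⇒Q = ℕ.+-cancelˡ-≡ 1 _ _ (begin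
      1 ℕ.+ ∑ (λ u → [ Q? u ])                          ≡⟨ cong (ℕ._+ ∑ (λ u → [ Q? u ])) (∑-[≡] 0#) ⟨
      ∑ (λ u → [ u ≟ 0# ]) ℕ.+ ∑ (λ u → [ Q? u ])       ≡⟨ ∑-+ (λ u → [ u ≟ 0# ]) (λ u → [ Q? u ]) ⟨
      ∑ (λ u → [ u ≟ 0# ] ℕ.+ [ Q? u ])                 ≡⟨ ∑-cong split ⟩
      ∑ (λ u → [ σ u ≟ (y * u) ])                       ≡⟨ linear-kernel ⟩
      q                                                 ≡⟨ ℕ.suc-pred q ⟨
      suc (ℕ.pred q)                                    ≡⟨⟩
      1 ℕ.+ (q ℕ.∸ 1)                                   ∎)
      where
      open ≡-Reasoning
      split : ∀ u → [ u ≟ 0# ] ℕ.+ [ Q? u ] ≡ [ σ u ≟ (y * u) ]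
      split u with u ≟ 0#
      ... | yes u≡0 = trans (cong suc ([]-no (Q? u) λ Qu → proj₁ (Q⇒ Qu) u≡0))
        (sym ([]-yes (σ u ≟ (y * u)) (subst (λ v → σ v ≡ y * v) (sym u≡0) (trans σ-0 (sym (zeroʳ y))))))
      ... | no u≢0 = []-⇔ (Q? u) (σ u ≟ (y * u)) (proj₂ ∘ Q⇒) (⇒Q u≢0)

  -- The binary form and the distribution of its values.

  -- The last two fields are Vieta's relations for `σ a` T² - (`σ b - b`) T - a, written without
  -- division. Norm 1 gives each linear factor of the form a kernel of q points, and distinctness
  -- makes the two kernels meet only in zero.
  record Split (a b : Carrier) : Set where
    field
      y₁ y₂     : Carrier
      norm₁     : σ y₁ * y₁ ≡ 1#
      norm₂     : σ y₂ * y₂ ≡ 1#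
      y₁≢y₂     : y₁ ≢ y₂
      y₁+y₂     : σ a * (y₁ + y₂) ≡ σ b - b
      y₁*y₂     : σ a * (y₁ * y₂) ≡ - a

  module QuadraticForm (a b : Carrier) (a≢0 : a ≢ 0#) where

    β : Carrier
    β = σ b - b

    form : Carrier → Carrier
    form x = σ a * x ^ (2 ℕ.* q) - a * x ^ 2 - β * x ^ (q ℕ.+ 1)

    form-σ : ∀ x → form x ≡ σ a * (σ x * σ x) - a * (x * x) - β * (σ x * x)
    form-σ x = cong₂ _-_ (cong₂ (λ u v → σ a * u - a * v) 2q (cong (x *_) (*-identityʳ x)))
                         (cong (β *_) (trans (^-+ x q 1) (cong (σ x *_) (*-identityʳ x))))
      where
      2q : x ^ (2 ℕ.* q) ≡ σ x * σ x
      2q = trans (^-+ x q (q ℕ.+ 0)) (cong (λ n → σ x * x ^ n) (ℕ.+-identityʳ q))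

    σβ : σ β ≡ - β
    σβ = begin
      σ (σ b - b)     ≡⟨ trans (σ-- (σ b) b) (cong (_- σ b) (σ-σ b)) ⟩
      b - σ b         ≡⟨ solve 2 (λ b s → b :- s := :- (s :- b)) refl b (σ b) ⟩
      - β             ∎
      where open ≡-Reasoning

    -- Conjugation exchanges the two squared terms, fixes `σ x * x` and negates `β`.
    form-skew : ∀ x → σ (form x) ≡ - form x
    form-skew x = begin
      σ (form x)                                                         ≡⟨ cong σ (form-σ x) ⟩
      σ (σ a * (σ x * σ x) - a * (x * x) - β * (σ x * x))                ≡⟨ trans (σ-- _ _) (cong (_- σ (β * (σ x * x))) (σ-- _ _)) ⟩
      σ (σ a * (σ x * σ x)) - σ (a * (x * x)) - σ (β * (σ x * x))        ≡⟨ cong₂ _-_ (cong₂ _-_ e₁ e₂) e₃ ⟩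
      a * (x * x) - σ a * (σ x * σ x) - - β * (x * σ x)                  ≡⟨ solve 5 (λ a s x t β →
                                                                             a :* (x :* x) :- s :* (t :* t) :- (:- β) :* (x :* t) :=
                                                                             :- (s :* (t :* t) :- a :* (x :* x) :- β :* (t :* x)))
                                                                             refl a (σ a) x (σ x) β ⟩
      - (σ a * (σ x * σ x) - a * (x * x) - β * (σ x * x))                ≡⟨ cong (-_) (form-σ x) ⟨
      - form x                                                           ∎
      where
      open ≡-Reasoning
      σ-xx : ∀ z → σ (z * z) ≡ σ z * σ z
      σ-xx z = σ-* z z
      e₁ : σ (σ a * (σ x * σ x)) ≡ a * (x * x)
      e₁ = trans (σ-* _ _) (cong₂ _*_ (σ-σ a) (trans (σ-xx (σ x)) (cong (λ z → z * z) (σ-σ x))))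
      e₂ : σ (a * (x * x)) ≡ σ a * (σ x * σ x)
      e₂ = trans (σ-* _ _) (cong (σ a *_) (σ-xx x))
      e₃ : σ (β * (σ x * x)) ≡ - β * (x * σ x)
      e₃ = trans (σ-* _ _) (cong₂ _*_ σβ (trans (σ-* _ _) (cong (_* σ x) (σ-σ x))))

    module _ (split : Split a b) where
      open Split split

      δ : Carrier
      δ = y₁ - y₂

      δ≢0 : δ ≢ 0#
      δ≢0 = y₁≢y₂ ∘ x-y≡0⇒x≡y

      σa≢0 : σ a ≢ 0#
      σa≢0 = σ-≢0 a≢0

      form-factors : ∀ x → form x ≡ σ a * ((σ x - y₁ * x) * (σ x - y₂ * x))
      form-factors x = begin
        form x                                                            ≡⟨ form-σ x ⟩
        σ a * (σ x * σ x) - a * (x * x) - β * (σ x * x)                   ≡⟨ solve 5 (λ s a x t β →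
                                                                              s :* (t :* t) :- a :* (x :* x) :- β :* (t :* x) :=
                                                                              s :* (t :* t) :+ (:- a) :* (x :* x) :- β :* (t :* x))
                                                                              refl (σ a) a x (σ x) β ⟩
        σ a * (σ x * σ x) + - a * (x * x) - β * (σ x * x)                 ≡⟨ cong₂ (λ u v → σ a * (σ x * σ x) + u * (x * x) - v * (σ x * x)) y₁*y₂ y₁+y₂ ⟨
        σ a * (σ x * σ x) + σ a * (y₁ * y₂) * (x * x) - σ a * (y₁ + y₂) * (σ x * x)
                                                                          ≡⟨ solve 5 (λ s x t u v →
                                                                              s :* (t :* t) :+ s :* (u :* v) :* (x :* x) :- s :* (u :+ v) :* (t :* x) :=
                                                                              s :* ((t :- u :* x) :* (t :- v :* x)))
                                                                              refl (σ a) x (σ x) y₁ y₂ ⟩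
        σ a * ((σ x - y₁ * x) * (σ x - y₂ * x))                           ∎
        where open ≡-Reasoning

      -- The zeros form the union of the two kernels, which share only `0#`. The 1 on the left
      -- counts that common point a second time and avoids a subtraction.
      form-zeros : ∑ (λ x → [ form x ≟ 0# ]) ℕ.+ 1 ≡ q ℕ.+ q
      form-zeros = begin
        ∑ (λ x → [ form x ≟ 0# ]) ℕ.+ 1                                       ≡⟨ cong (∑ (λ x → [ form x ≟ 0# ]) ℕ.+_) (∑-[≡] 0#) ⟨
        ∑ (λ x → [ form x ≟ 0# ]) ℕ.+ ∑ (λ x → [ x ≟ 0# ])                    ≡⟨ ∑-+ (λ x → [ form x ≟ 0# ]) (λ x → [ x ≟ 0# ]) ⟨
        ∑ (λ x → [ form x ≟ 0# ] ℕ.+ [ x ≟ 0# ])                              ≡⟨ ∑-cong inclusion-exclusion ⟩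
        ∑ (λ x → [ σ x ≟ (y₁ * x) ] ℕ.+ [ σ x ≟ (y₂ * x) ])                   ≡⟨ ∑-+ (λ x → [ σ x ≟ (y₁ * x) ]) (λ x → [ σ x ≟ (y₂ * x) ]) ⟩
        ∑ (λ x → [ σ x ≟ (y₁ * x) ]) ℕ.+ ∑ (λ x → [ σ x ≟ (y₂ * x) ])         ≡⟨ cong₂ ℕ._+_ (linear-kernel norm₁) (linear-kernel norm₂) ⟩
        q ℕ.+ q                                                               ∎
        where
        open ≡-Reasoning
        both : ∀ {x} → σ x ≡ y₁ * x → σ x ≡ y₂ * x → x ≡ 0#
        both {x} eq₁ eq₂ = x*y≡0⇒y≡0 δ≢0 (trans
          (solve 3 (λ u v x → (u :- v) :* x := u :* x :- v :* x) refl y₁ y₂ x)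
          (x≡y⇒x-y≡0 (trans (sym eq₁) eq₂)))
        root₁ : ∀ {x} → σ x ≡ y₁ * x → form x ≡ 0#
        root₁ {x} eq = trans (form-factors x) (trans (cong (λ u → σ a * (u * (σ x - y₂ * x))) (x≡y⇒x-y≡0 eq))
                                                     (trans (cong (σ a *_) (zeroˡ _)) (zeroʳ _)))
        root₂ : ∀ {x} → σ x ≡ y₂ * x → form x ≡ 0#
        root₂ {x} eq = trans (form-factors x) (trans (cong (λ u → σ a * ((σ x - y₁ * x) * u)) (x≡y⇒x-y≡0 eq))
                                                     (trans (cong (σ a *_) (zeroʳ _)) (zeroʳ _)))
        zero-fixed : ∀ y {x} → x ≡ 0# → σ x ≡ y * x
        zero-fixed y refl = trans σ-0 (sym (zeroʳ y))
        inclusion-exclusion : ∀ x → [ form x ≟ 0# ] ℕ.+ [ x ≟ 0# ] ≡ [ σ x ≟ (y₁ * x) ] ℕ.+ [ σ x ≟ (y₂ * x) ]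
        inclusion-exclusion x with σ x ≟ (y₁ * x) | σ x ≟ (y₂ * x)
        ... | yes p | yes q = cong₂ ℕ._+_ ([]-yes (form x ≟ 0#) (root₁ p)) ([]-yes (x ≟ 0#) (both p q))
        ... | yes p | no ¬q = cong₂ ℕ._+_ ([]-yes (form x ≟ 0#) (root₁ p)) ([]-no (x ≟ 0#) (¬q ∘ zero-fixed y₂))
        ... | no ¬p | yes q = cong₂ ℕ._+_ ([]-yes (form x ≟ 0#) (root₂ q)) ([]-no (x ≟ 0#) (¬p ∘ zero-fixed y₁))
        ... | no ¬p | no ¬q = cong₂ ℕ._+_ ([]-no (form x ≟ 0#) no-root) ([]-no (x ≟ 0#) (¬p ∘ zero-fixed y₁))
          where
          no-root : form x ≢ 0#
          no-root eq = x*y≢0 σa≢0 (x*y≢0 (¬p ∘ x-y≡0⇒x≡y) (¬q ∘ x-y≡0⇒x≡y)) (trans (sym (form-factors x)) eq)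

      -- Solutions of `form x ≡ c` are parametrised by their first factor u. The second factor must
      -- be `cofactor u`, and second minus first is `δ * x`, which recovers x as `section u`. The
      -- admissible u are the non-zero solutions of `σ u ≡ - σ y₁ * u`, of which there are q - 1.
      module NonzeroValue {c : Carrier} (c≢0 : c ≢ 0#) (c-skew : σ c ≡ - c) where

        Q : Carrier → Set
        Q u = u ≢ 0# × σ u ≡ - σ y₁ * u

        Q? : ∀ u → Dec (Q u)
        Q? u = ¬? (u ≟ 0#) ×-dec (σ u ≟ (- σ y₁ * u))

        cofactor : Carrier → Carrier
        cofactor u = c * (σ a * u) ⁻¹

        section : Carrier → Carrier
        section u = (cofactor u - u) * δ ⁻¹

        *-cofactor : ∀ {u} → u ≢ 0# → σ a * (u * cofactor u) ≡ c
        *-cofactor {u} u≢0 = begin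
          σ a * (u * (c * i))     ≡⟨ solve 4 (λ s u c i → s :* (u :* (c :* i)) := c :* (s :* u :* i)) refl (σ a) u c i ⟩
          c * (σ a * u * i)       ≡⟨ cong (c *_) (⁻¹-inverse (σ a * u) (x*y≢0 σa≢0 u≢0)) ⟩
          c * 1#                  ≡⟨ *-identityʳ c ⟩
          c                       ∎
          where
          open ≡-Reasoning
          i = (σ a * u) ⁻¹

        δ*section : ∀ u → δ * section u ≡ cofactor u - u
        δ*section u = begin
          δ * ((cofactor u - u) * δ ⁻¹)   ≡⟨ solve 3 (λ d e i → d :* (e :* i) := e :* (d :* i)) refl δ (cofactor u - u) (δ ⁻¹) ⟩
          (cofactor u - u) * (δ * δ ⁻¹)   ≡⟨ cong ((cofactor u - u) *_) (⁻¹-inverse δ δ≢0) ⟩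
          (cofactor u - u) * 1#           ≡⟨ *-identityʳ _ ⟩
          cofactor u - u                  ∎
          where open ≡-Reasoning

        factor≢0 : ∀ {x} → form x ≡ c → σ x - y₁ * x ≢ 0#
        factor≢0 {x} fx≡c eq = c≢0 (trans (sym fx≡c) (trans (form-factors x)
          (trans (cong (λ u → σ a * (u * (σ x - y₂ * x))) eq) (trans (cong (σ a *_) (zeroˡ _)) (zeroʳ _)))))

        section-factor : ∀ x → form x ≡ c → section (σ x - y₁ * x) ≡ x
        section-factor x fx≡c = *-cancelˡ δ≢0 (begin
          δ * section u         ≡⟨ δ*section u ⟩
          cofactor u - u        ≡⟨ cong (_- u) (*-cancelˡ (factor≢0 fx≡c) (*-cancelˡ σa≢0
                                     (trans (*-cofactor (factor≢0 fx≡c)) (trans (sym fx≡c) (form-factors x))))) ⟩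
          σ x - y₂ * x - u      ≡⟨ solve 4 (λ t x u v → (t :- v :* x) :- (t :- u :* x) := (u :- v) :* x) refl (σ x) x y₁ y₂ ⟩
          δ * x                 ∎)
          where
          open ≡-Reasoning
          u = σ x - y₁ * x

        -- Conjugating σ a * u * cofactor u = c and cancelling, using a = - σ a * y₁ * y₂.
        σ-cofactor : ∀ {u} → Q u → σ (cofactor u) ≡ - σ y₂ * cofactor u
        σ-cofactor {u} (u≢0 , σu) = *-cancelˡ u≢0 (*-cancelˡ σa≢0 (begin
          σ a * (u * σ e)                                 ≡⟨ cong (λ z → σ a * (z * σ e)) (*-identityˡ u) ⟨
          σ a * (1# * u * σ e)                            ≡⟨ cong (λ z → σ a * (z * u * σ e)) norm₁ ⟨
          σ a * (σ y₁ * y₁ * u * σ e)                     ≡⟨ cong (λ z → σ a * (z * u * σ e)) (*-identityʳ _) ⟨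
          σ a * (σ y₁ * y₁ * 1# * u * σ e)                ≡⟨ cong (λ z → σ a * (σ y₁ * y₁ * z * u * σ e)) norm₂ ⟨
          σ a * (σ y₁ * y₁ * (σ y₂ * y₂) * u * σ e)       ≡⟨ solve 7 (λ A s₁ y₁ s₂ y₂ u t →
                                                               A :* (s₁ :* y₁ :* (s₂ :* y₂) :* u :* t) :=
                                                               (:- s₂) :* ((A :* (y₁ :* y₂)) :* (((:- s₁) :* u) :* t)))
                                                               refl (σ a) (σ y₁) y₁ (σ y₂) y₂ u (σ e) ⟩
          - σ y₂ * (σ a * (y₁ * y₂) * (- σ y₁ * u * σ e)) ≡⟨ cong₂ (λ z w → - σ y₂ * (z * (w * σ e))) y₁*y₂ (sym σu) ⟩
          - σ y₂ * (- a * (σ u * σ e))                    ≡⟨ solve 3 (λ s a w → (:- s) :* ((:- a) :* w) := s :* (a :* w)) refl (σ y₂) a (σ u * σ e) ⟩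
          σ y₂ * (a * (σ u * σ e))                        ≡⟨ cong (σ y₂ *_) conjugate ⟩
          σ y₂ * - c                                      ≡⟨ cong (λ z → σ y₂ * - z) (*-cofactor u≢0) ⟨
          σ y₂ * - (σ a * (u * e))                        ≡⟨ solve 4 (λ s A u e → s :* (:- (A :* (u :* e))) := A :* (u :* ((:- s) :* e)))
                                                               refl (σ y₂) (σ a) u e ⟩
          σ a * (u * (- σ y₂ * e))                        ∎))
          where
          open ≡-Reasoning
          e = cofactor u
          conjugate : a * (σ u * σ e) ≡ - c
          conjugate = begin
            a * (σ u * σ e)           ≡⟨ cong₂ _*_ (σ-σ a) (σ-* u e) ⟨
            σ (σ a) * σ (u * e)       ≡⟨ σ-* (σ a) (u * e) ⟨
            σ (σ a * (u * e))         ≡⟨ cong σ (*-cofactor u≢0) ⟩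
            σ c                       ≡⟨ c-skew ⟩
            - c                       ∎

        factor-section : ∀ u → Q u → σ (section u) - y₁ * section u ≡ u
        factor-section u Qu@(u≢0 , σu) = trans (cong (_- y₁ * x) σx≡) (solve 2 (λ w u → (w :+ u) :- w := u) refl (y₁ * x) u)
          where
          open ≡-Reasoning
          x = section u
          e = cofactor u
          s₁ = σ y₁
          s₂ = σ y₂
          σδσx : σ δ * σ x ≡ s₁ * u - s₂ * e
          σδσx = begin
            σ δ * σ x                         ≡⟨ σ-* δ x ⟨
            σ (δ * x)                         ≡⟨ cong σ (δ*section u) ⟩
            σ (e - u)                         ≡⟨ σ-- e u ⟩
            σ e - σ u                         ≡⟨ cong₂ _-_ (σ-cofactor Qu) σu ⟩
            - s₂ * e - - s₁ * u               ≡⟨ solve 4 (λ s₁ s₂ u e → (:- s₂) :* e :- (:- s₁) :* u := s₁ :* u :- s₂ :* e) refl s₁ s₂ u e ⟩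
            s₁ * u - s₂ * e                   ∎
          -- The factors δ and `σ δ` clear the denominators of x and of its conjugate; they are
          -- cancelled at the end.
          scaled : δ * (σ δ * σ x) ≡ δ * (σ δ * (y₁ * x + u))
          scaled = begin
            δ * (σ δ * σ x)                                           ≡⟨ cong (δ *_) σδσx ⟩
            (y₁ - y₂) * (s₁ * u - s₂ * e)                             ≡⟨ solve 6 (λ y₁ y₂ s₁ s₂ u e →
                                                                          (y₁ :- y₂) :* (s₁ :* u :- s₂ :* e) :=
                                                                          (s₁ :* y₁) :* u :- s₁ :* y₂ :* u :- s₂ :* y₁ :* e :+ (s₂ :* y₂) :* e)
                                                                          refl y₁ y₂ s₁ s₂ u e ⟩
            -- Both norms are 1, so they may be interchanged; only afterwards does the expression
            -- contain the factor `s₁ - s₂`.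
            s₁ * y₁ * u - s₁ * y₂ * u - s₂ * y₁ * e + s₂ * y₂ * e     ≡⟨ cong₂ (λ z w → z * u - s₁ * y₂ * u - s₂ * y₁ * e + w * e)
                                                                          (trans norm₁ (sym norm₂)) (trans norm₂ (sym norm₁)) ⟩
            s₂ * y₂ * u - s₁ * y₂ * u - s₂ * y₁ * e + s₁ * y₁ * e     ≡⟨ solve 6 (λ y₁ y₂ s₁ s₂ u e →
                                                                          s₂ :* y₂ :* u :- s₁ :* y₂ :* u :- s₂ :* y₁ :* e :+ s₁ :* y₁ :* e :=
                                                                          (s₁ :- s₂) :* (y₁ :* (e :- u) :+ (y₁ :- y₂) :* u))
                                                                          refl y₁ y₂ s₁ s₂ u e ⟩
            (s₁ - s₂) * (y₁ * (e - u) + δ * u)                        ≡⟨ cong₂ (λ z w → z * (y₁ * w + δ * u)) (σ-- y₁ y₂) (δ*section u) ⟨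
            σ δ * (y₁ * (δ * x) + δ * u)                              ≡⟨ solve 5 (λ d t y x u → t :* (y :* (d :* x) :+ d :* u) := d :* (t :* (y :* x :+ u)))
                                                                          refl δ (σ δ) y₁ x u ⟩
            δ * (σ δ * (y₁ * x + u))                                  ∎
          σx≡ : σ x ≡ y₁ * x + u
          σx≡ = *-cancelˡ (σ-≢0 δ≢0) (*-cancelˡ δ≢0 scaled)

        form-section : ∀ u → Q u → form (section u) ≡ c
        form-section u Qu@(u≢0 , _) = begin
          form x                                      ≡⟨ form-factors x ⟩
          σ a * ((σ x - y₁ * x) * (σ x - y₂ * x))     ≡⟨ cong (λ z → σ a * ((σ x - y₁ * x) * z))
                                                           (solve 4 (λ t x u v → t :- v :* x := (t :- u :* x) :+ (u :- v) :* x) refl (σ x) x y₁ y₂) ⟩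
          σ a * ((σ x - y₁ * x) * (σ x - y₁ * x + δ * x))
                                                      ≡⟨ cong₂ (λ z w → σ a * (z * (z + w))) (factor-section u Qu) (δ*section u) ⟩
          σ a * (u * (u + (cofactor u - u)))          ≡⟨ cong (λ z → σ a * (u * z)) (solve 2 (λ u e → u :+ (e :- u) := e) refl u (cofactor u)) ⟩
          σ a * (u * cofactor u)                      ≡⟨ *-cofactor u≢0 ⟩
          c                                           ∎
          where
          open ≡-Reasoning
          x = section u

        form-fibre : ∑ (λ x → [ form x ≟ c ]) ≡ q ℕ.∸ 1
        form-fibre = trans
          (∑-bijection (λ x → form x ≟ c) Q? (λ x → σ x - y₁ * x) section
            (λ x fx≡c → factor≢0 fx≡c , σ-linear norm₁ x) form-section section-factor factor-section)
          (linear-kernel∖0 (norm-conjugate norm₁) Q? (λ Qu → Qu) _,_)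

      -- Writing 2q - 1 as (q - 1) + q puts zero and non-zero values into one formula, a constant
      -- plus a multiple of the bracket at zero. This shape survives the passage to several
      -- coordinates.
      form-fibre : ∀ c → σ c ≡ - c → ∑ (λ x → [ form x ≟ c ]) ≡ (q ℕ.∸ 1) ℕ.+ q ℕ.* [ c ≟ 0# ]
      form-fibre c c-skew with c ≟ 0#
      ... | no c≢0 = trans (NonzeroValue.form-fibre c≢0 c-skew)
                           (sym (trans (cong ((q ℕ.∸ 1) ℕ.+_) (ℕ.*-zeroʳ q)) (ℕ.+-identityʳ _)))
      ... | yes refl = ℕ.+-cancelʳ-≡ 1 _ _ (begin
        ∑ (λ x → [ form x ≟ 0# ]) ℕ.+ 1     ≡⟨ form-zeros ⟩
        q ℕ.+ q                             ≡⟨ cong (ℕ._+ q) (ℕ.m∸n+n≡m (ℕ.≤-trans (s≤s z≤n) 2≤q)) ⟨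
        (q ℕ.∸ 1) ℕ.+ 1 ℕ.+ q               ≡⟨ ℕ.+-assoc (q ℕ.∸ 1) 1 q ⟩
        (q ℕ.∸ 1) ℕ.+ (1 ℕ.+ q)             ≡⟨ cong ((q ℕ.∸ 1) ℕ.+_) (trans (ℕ.+-comm 1 q) (cong (ℕ._+ 1) (sym (ℕ.*-identityʳ q)))) ⟩
        (q ℕ.∸ 1) ℕ.+ (q ℕ.* 1 ℕ.+ 1)       ≡⟨ ℕ.+-assoc (q ℕ.∸ 1) (q ℕ.* 1) 1 ⟨
        (q ℕ.∸ 1) ℕ.+ q ℕ.* 1 ℕ.+ 1         ∎)
        where open ≡-Reasoning

  -- The factorisation in odd characteristic.

  σ*≡^ : ∀ x → x ^ (q ℕ.+ 1) ≡ σ x * x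
  σ*≡^ x = trans (^-+ x q 1) (cong (σ x *_) (*-identityʳ x))

  ^2≡ : ∀ x → x ^ 2 ≡ x * x
  ^2≡ x = cong (x *_) (*-identityʳ x)

  -- The norm of the quotient w / t, phrased through the product so that no inverse has to be
  -- conjugated.
  norm-from-multiple : ∀ {t y w} → t ≢ 0# → t * y ≡ w → σ w * w ≡ σ t * t → σ y * y ≡ 1#
  norm-from-multiple {t} {y} {w} t≢0 ty≡w eq = *-cancelˡ (x*y≢0 (σ-≢0 t≢0) t≢0) (begin
    σ t * t * (σ y * y)       ≡⟨ solve 4 (λ s t u y → s :* t :* (u :* y) := (s :* u) :* (t :* y)) refl (σ t) t (σ y) y ⟩
    σ t * σ y * (t * y)       ≡⟨ cong₂ _*_ (trans (sym (σ-* t y)) (cong σ ty≡w)) ty≡w ⟩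
    σ w * w                   ≡⟨ eq ⟩
    σ t * t                   ≡⟨ *-identityʳ _ ⟨
    σ t * t * 1#              ∎)
    where open ≡-Reasoning

  *-*⁻¹ : ∀ {t} w → t ≢ 0# → t * (w * t ⁻¹) ≡ w
  *-*⁻¹ {t} w t≢0 = begin
    t * (w * t ⁻¹)    ≡⟨ solve 3 (λ t w i → t :* (w :* i) := w :* (t :* i)) refl t w (t ⁻¹) ⟩
    w * (t * t ⁻¹)    ≡⟨ cong (w *_) (⁻¹-inverse t t≢0) ⟩
    w * 1#            ≡⟨ *-identityʳ w ⟩
    w                 ∎
    where open ≡-Reasoning

  -- The quadratic formula: the roots are β ± s over t, where t is twice `σ a` and s is the given
  -- square root of the discriminant. Since `σ` fixes s and negates β, both numerators have norm s²
  -- - β² = 4 `σ a * a`, which is the norm of t. A non-zero discriminant keeps the roots apart.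
  odd-split : ∀ {a} b → a ≢ 0# → 1# + 1# ≢ 0# → OddCondition q a b → Split a b
  odd-split {a} b a≢0 2≢0 (Δ≢0 , s , σs , s*s≡Δ) = record
    { y₁ = y₁ ; y₂ = y₂
    ; norm₁ = norm-from-multiple t≢0 ty₁ (norm-numerator (β + s) norm-β+s)
    ; norm₂ = norm-from-multiple t≢0 ty₂ (norm-numerator (β - s) norm-β-s)
    ; y₁≢y₂ = λ y₁≡y₂ → x*y≢0 2≢0 s≢0 (begin
        (1# + 1#) * s             ≡⟨ double s ⟩
        s + s                     ≡⟨ solve 2 (λ β s → s :+ s := (β :+ s) :- (β :- s)) refl β s ⟩
        β + s - (β - s)           ≡⟨ cong₂ _-_ ty₁ ty₂ ⟨
        t * y₁ - t * y₂           ≡⟨ x≡y⇒x-y≡0 (cong (t *_) y₁≡y₂) ⟩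
        0#                        ∎)
    ; y₁+y₂ = *-cancelˡ 2≢0 (begin
        (1# + 1#) * (σ a * (y₁ + y₂))   ≡⟨ double _ ⟩
        σ a * (y₁ + y₂) + σ a * (y₁ + y₂) ≡⟨ solve 3 (λ A u v → A :* (u :+ v) :+ A :* (u :+ v) := (A :+ A) :* u :+ (A :+ A) :* v) refl (σ a) y₁ y₂ ⟩
        t * y₁ + t * y₂                 ≡⟨ cong₂ _+_ ty₁ ty₂ ⟩
        β + s + (β - s)                 ≡⟨ solve 2 (λ β s → β :+ s :+ (β :- s) := β :+ β) refl β s ⟩
        β + β                           ≡⟨ double β ⟨
        (1# + 1#) * β                   ∎)
    ; y₁*y₂ = *-cancelˡ (x*y≢0 2≢0 t≢0) (begin
        (1# + 1#) * t * (σ a * (y₁ * y₂)) ≡⟨ cong (_* (σ a * (y₁ * y₂))) (double t) ⟩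
        (t + t) * (σ a * (y₁ * y₂))     ≡⟨ solve 3 (λ A u v → (A :+ A :+ (A :+ A)) :* (A :* (u :* v)) := ((A :+ A) :* u) :* ((A :+ A) :* v)) refl (σ a) y₁ y₂ ⟩
        t * y₁ * (t * y₂)               ≡⟨ cong₂ _*_ ty₁ ty₂ ⟩
        (β + s) * (β - s)               ≡⟨ solve 2 (λ β s → (β :+ s) :* (β :- s) := β :* β :- s :* s) refl β s ⟩
        β * β - s * s                   ≡⟨ cong (λ d → β * β - d) s*s≡ ⟩
        β * β - (N + N + N + N + β * β) ≡⟨ solve 3 (λ a A β → β :* β :- (A :* a :+ A :* a :+ A :* a :+ A :* a :+ β :* β) := (A :+ A :+ (A :+ A)) :* (:- a)) refl a (σ a) β ⟩
        (t + t) * - a                   ≡⟨ cong (_* - a) (double t) ⟨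
        (1# + 1#) * t * - a             ∎)
    }
    where
    open ≡-Reasoning
    open QuadraticForm a b a≢0 using (β; σβ)
    t N y₁ y₂ : Carrier
    t = σ a + σ a
    N = σ a * a
    y₁ = (β + s) * t ⁻¹
    y₂ = (β - s) * t ⁻¹
    double : ∀ x → (1# + 1#) * x ≡ x + x
    double x = trans (distribʳ x 1# 1#) (cong₂ _+_ (*-identityˡ x) (*-identityˡ x))
    t≢0 : t ≢ 0#
    t≢0 t≡0 = x*y≢0 2≢0 (σ-≢0 a≢0) (trans (double (σ a)) t≡0)
    ty₁ : t * y₁ ≡ β + s
    ty₁ = *-*⁻¹ (β + s) t≢0
    ty₂ : t * y₂ ≡ β - s
    ty₂ = *-*⁻¹ (β - s) t≢0
    s*s≡ : s * s ≡ N + N + N + N + β * β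
    s*s≡ = begin
      s * s                                 ≡⟨ s*s≡Δ ⟩
      four * a ^ (q ℕ.+ 1) + β ^ 2          ≡⟨ cong₂ (λ n d → four * n + d) (σ*≡^ a) (^2≡ β) ⟩
      (1# + 1# + 1# + 1#) * N + β * β       ≡⟨ cong (_+ β * β) (solve 2 (λ e n → (e :+ e :+ e :+ e) :* n := e :* n :+ e :* n :+ e :* n :+ e :* n) refl 1# N) ⟩
      1# * N + 1# * N + 1# * N + 1# * N + β * β ≡⟨ cong (λ n → n + n + n + n + β * β) (*-identityˡ N) ⟩
      N + N + N + N + β * β                 ∎
    s≢0 : s ≢ 0#
    s≢0 s≡0 = Δ≢0 (trans (sym s*s≡Δ) (trans (cong (_* s) s≡0) (zeroˡ s)))
    norm-t : σ t * t ≡ N + N + N + N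
    norm-t = trans (cong (_* t) (trans (σ-+ (σ a) (σ a)) (cong (λ z → z + z) (σ-σ a))))
      (solve 2 (λ a A → (a :+ a) :* (A :+ A) := A :* a :+ A :* a :+ A :* a :+ A :* a) refl a (σ a))
    norm-numerator : ∀ w → σ w * w ≡ s * s - β * β → σ w * w ≡ σ t * t
    norm-numerator w eq = begin
      σ w * w                               ≡⟨ eq ⟩
      s * s - β * β                         ≡⟨ cong (_- β * β) s*s≡ ⟩
      N + N + N + N + β * β - β * β         ≡⟨ solve 2 (λ n d → (n :+ d) :- d := n) refl (N + N + N + N) (β * β) ⟩
      N + N + N + N                         ≡⟨ norm-t ⟨
      σ t * t                               ∎
    norm-β+s : σ (β + s) * (β + s) ≡ s * s - β * β
    norm-β+s = trans (cong (_* (β + s)) (trans (σ-+ β s) (cong₂ _+_ σβ σs)))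
      (solve 2 (λ β s → ((:- β) :+ s) :* (β :+ s) := s :* s :- β :* β) refl β s)
    norm-β-s : σ (β - s) * (β - s) ≡ s * s - β * β
    norm-β-s = trans (cong (_* (β - s)) (trans (σ-- β s) (cong₂ _-_ σβ σs)))
      (solve 2 (λ β s → ((:- β) :- s) :* (β :- s) := s :* s :- β :* β) refl β s)

  -- Characteristic 2: traces and the Artin-Schreier equation.

  module EvenCharacteristic (1+1≡0 : 1# + 1# ≡ 0#) where
    open ≡-Reasoning

    x+x≡0 : ∀ x → x + x ≡ 0#
    x+x≡0 x = trans (sym (cong₂ _+_ (*-identityˡ x) (*-identityˡ x)))
                (trans (sym (distribʳ x 1# 1#)) (trans (cong (_* x) 1+1≡0) (zeroˡ x)))

    -- The solver computes with integer coefficients. An identity that holds only in characteristic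
    -- 2 is therefore solved with its even part `d + d` made explicit, and that part is then
    -- dropped.
    mod-2 : ∀ {x y} d → x ≡ y + (d + d) → x ≡ y
    mod-2 {x} {y} d eq = trans eq (trans (cong (y +_) (x+x≡0 d)) (+-identityʳ y))

    -x≡x : ∀ x → - x ≡ x
    -x≡x x = sym (mod-2 x (solve 1 (λ x → x := (:- x) :+ (x :+ x)) refl x))

    square-+ : ∀ x y → (x + y) * (x + y) ≡ x * x + y * y
    square-+ x y = mod-2 (x * y) (solve 2 (λ x y → (x :+ y) :* (x :+ y) := x :* x :+ y :* y :+ (x :* y :+ x :* y)) refl x y)

    infixr 9 _^2^_
    _^2^_ : Carrier → ℕ → Carrier
    x ^2^ n = x ^ (2 ℕ.^ n)

    ^2^-suc : ∀ x n → x ^2^ suc n ≡ x ^2^ n * x ^2^ n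
    ^2^-suc x n = trans (^-+ x (2 ℕ.^ n) (2 ℕ.^ n ℕ.+ 0)) (cong (λ k → x ^2^ n * x ^ k) (ℕ.+-identityʳ (2 ℕ.^ n)))

    Tr-suc : ∀ n x → Tr (suc n) x ≡ Tr n x + x ^2^ n
    Tr-suc n x = trans (sumFin-snoc n (λ i → x ^2^ toℕ i))
      (cong₂ _+_ (sumFin-cong n λ i → cong (x ^2^_) (Fin.toℕ-inject₁ i)) (cong (x ^2^_) (Fin.toℕ-fromℕ n)))

    -- Squaring moves each term of the trace to the next one, and the first term x is put back.
    Tr-square : ∀ n x → Tr n x * Tr n x + x ≡ Tr (suc n) x
    Tr-square zero    x = trans (cong (_+ x) (zeroˡ 0#)) (trans (+-comm 0# x) (cong (_+ 0#) (sym (*-identityʳ x))))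
    Tr-square (suc n) x = begin
      Tr (suc n) x * Tr (suc n) x + x                     ≡⟨ cong (λ t → t * t + x) (Tr-suc n x) ⟩
      (Tr n x + x ^2^ n) * (Tr n x + x ^2^ n) + x         ≡⟨ cong (_+ x) (square-+ _ _) ⟩
      Tr n x * Tr n x + x ^2^ n * x ^2^ n + x             ≡⟨ solve 3 (λ s t x → s :+ t :+ x := s :+ x :+ t) refl _ _ x ⟩
      Tr n x * Tr n x + x + x ^2^ n * x ^2^ n             ≡⟨ cong₂ _+_ (Tr-square n x) (sym (^2^-suc x n)) ⟩
      Tr (suc n) x + x ^2^ suc n                          ≡⟨ Tr-suc (suc n) x ⟨
      Tr (suc (suc n)) x                                  ∎

    ^2^-artin-schreier : ∀ n w → (w * w + w) ^2^ n ≡ w ^2^ suc n + w ^2^ n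
    ^2^-artin-schreier zero    w = trans (*-identityʳ _) (cong₂ _+_ (sym (^2≡ w)) (sym (*-identityʳ w)))
    ^2^-artin-schreier (suc n) w = begin
      (w * w + w) ^2^ suc n                                               ≡⟨ ^2^-suc (w * w + w) n ⟩
      (w * w + w) ^2^ n * (w * w + w) ^2^ n                               ≡⟨ cong (λ t → t * t) (^2^-artin-schreier n w) ⟩
      (w ^2^ suc n + w ^2^ n) * (w ^2^ suc n + w ^2^ n)                   ≡⟨ square-+ _ _ ⟩
      w ^2^ suc n * w ^2^ suc n + w ^2^ n * w ^2^ n                       ≡⟨ cong₂ _+_ (^2^-suc w (suc n)) (^2^-suc w n) ⟨
      w ^2^ suc (suc n) + w ^2^ suc n                                     ∎

    -- The sum telescopes. At n = h it expresses `σ w + w` as a trace.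
    Tr-artin-schreier : ∀ n w → Tr n (w * w + w) ≡ w ^2^ n + w
    Tr-artin-schreier zero    w = sym (trans (cong (_+ w) (*-identityʳ w)) (x+x≡0 w))
    Tr-artin-schreier (suc n) w = begin
      Tr (suc n) (w * w + w)                        ≡⟨ Tr-suc n (w * w + w) ⟩
      Tr n (w * w + w) + (w * w + w) ^2^ n          ≡⟨ cong₂ _+_ (Tr-artin-schreier n w) (^2^-artin-schreier n w) ⟩
      w ^2^ n + w + (w ^2^ suc n + w ^2^ n)         ≡⟨ mod-2 (w ^2^ n) (solve 3 (λ u w v → u :+ w :+ (v :+ u) := v :+ w :+ (u :+ u)) refl (w ^2^ n) w (w ^2^ suc n)) ⟩
      w ^2^ suc n + w                               ∎

    module _ (h : ℕ) (q≡2^h : q ≡ 2 ℕ.^ h) where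

      ^2^h : ∀ x → x ^2^ h ≡ σ x
      ^2^h x = cong (x ^_) (sym q≡2^h)

      -- Additive Hilbert 90: from one w with σ w = w + 1, the element w + Σ_{i<h} Tr i κ * μ^(2^i),
      -- where μ = w² + w has trace 1, solves z² + z = κ.
      artin-schreier-solution : ∀ {κ w} → Tr h κ ≡ 1# → σ w ≡ w + 1# → ∃ λ z → z * z + z ≡ κ × σ z ≡ z + 1#
      artin-schreier-solution {κ} {w} Trκ≡1 σw = z , z²+z , σz
        where
        μ : Carrier
        μ = w * w + w
        Z : ℕ → Carrier
        Z zero    = w
        Z (suc n) = Z n + Tr n κ * μ ^2^ n
        z : Carrier
        z = Z h
        -- The invariant of the partial sums. At n = h both traces are 1 and `μ ^2^ h` is `σ μ`,
        -- that is μ, so the two copies of μ cancel and κ remains.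
        partial : ∀ n → Z n * Z n + Z n ≡ μ + Tr n κ * μ ^2^ n + κ * (Tr n μ * Tr n μ)
        partial zero    = sym (trans (cong₂ (λ u v → μ + u + κ * v) (zeroˡ _) (zeroˡ 0#))
          (trans (cong (μ + 0# +_) (zeroʳ κ)) (trans (+-identityʳ _) (+-identityʳ _))))
        partial (suc n) = begin
          (Z n + S * e) * (Z n + S * e) + (Z n + S * e)
            ≡⟨ cong (_+ (Z n + S * e)) (square-+ (Z n) (S * e)) ⟩
          Z n * Z n + S * e * (S * e) + (Z n + S * e)
            ≡⟨ solve 3 (λ Z S e → Z :* Z :+ S :* e :* (S :* e) :+ (Z :+ S :* e) := Z :* Z :+ Z :+ (S :* S :* (e :* e) :+ S :* e)) refl (Z n) S e ⟩
          Z n * Z n + Z n + (S * S * (e * e) + S * e)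
            ≡⟨ cong (_+ (S * S * (e * e) + S * e)) (partial n) ⟩
          μ + S * e + κ * (T * T) + (S * S * (e * e) + S * e)
            ≡⟨ mod-2 (S * e) (solve 5 (λ μ S e κ T → μ :+ S :* e :+ κ :* (T :* T) :+ (S :* S :* (e :* e) :+ S :* e) :=
                                        μ :+ S :* S :* (e :* e) :+ κ :* (T :* T) :+ (S :* e :+ S :* e)) refl μ S e κ T) ⟩
          μ + S * S * (e * e) + κ * (T * T)
            ≡⟨ mod-2 (κ * (e * e)) (solve 5 (λ μ S e κ T → μ :+ (S :* S :+ κ) :* (e :* e) :+ κ :* (T :* T :+ e :* e) :=
                                        μ :+ S :* S :* (e :* e) :+ κ :* (T :* T) :+ (κ :* (e :* e) :+ κ :* (e :* e))) refl μ S e κ T) ⟨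
          μ + (S * S + κ) * (e * e) + κ * (T * T + e * e)
            ≡⟨ cong₂ (λ u v → μ + u * v + κ * (T * T + e * e)) (Tr-square n κ) (sym (^2^-suc μ n)) ⟩
          μ + Tr (suc n) κ * μ ^2^ suc n + κ * (T * T + e * e)
            ≡⟨ cong (λ u → μ + Tr (suc n) κ * μ ^2^ suc n + κ * u) (square-+ T e) ⟨
          μ + Tr (suc n) κ * μ ^2^ suc n + κ * ((T + e) * (T + e))
            ≡⟨ cong (λ u → μ + Tr (suc n) κ * μ ^2^ suc n + κ * (u * u)) (Tr-suc n μ) ⟨
          μ + Tr (suc n) κ * μ ^2^ suc n + κ * (Tr (suc n) μ * Tr (suc n) μ)  ∎
          where
          S = Tr n κ
          e = μ ^2^ n
          T = Tr n μ
        Trμ≡1 : Tr h μ ≡ 1#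
        Trμ≡1 = begin
          Tr h μ            ≡⟨ Tr-artin-schreier h w ⟩
          w ^2^ h + w       ≡⟨ cong (_+ w) (trans (^2^h w) σw) ⟩
          w + 1# + w        ≡⟨ mod-2 w (solve 2 (λ w e → w :+ e :+ w := e :+ (w :+ w)) refl w 1#) ⟩
          1#                ∎
        σμ : σ μ ≡ μ
        σμ = begin
          σ (w * w + w)                   ≡⟨ trans (σ-+ (w * w) w) (cong (_+ σ w) (σ-* w w)) ⟩
          σ w * σ w + σ w                 ≡⟨ cong (λ t → t * t + t) σw ⟩
          (w + 1#) * (w + 1#) + (w + 1#)  ≡⟨ cong (_+ (w + 1#)) (trans (square-+ w 1#) (cong (w * w +_) (*-identityˡ 1#))) ⟩
          w * w + 1# + (w + 1#)           ≡⟨ mod-2 1# (solve 2 (λ w e → w :* w :+ e :+ (w :+ e) := w :* w :+ w :+ (e :+ e)) refl w 1#) ⟩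
          μ                               ∎
        z²+z : z * z + z ≡ κ
        z²+z = begin
          z * z + z                                               ≡⟨ partial h ⟩
          μ + Tr h κ * μ ^2^ h + κ * (Tr h μ * Tr h μ)            ≡⟨ cong₂ (λ s t → μ + s * μ ^2^ h + κ * (t * t)) Trκ≡1 Trμ≡1 ⟩
          μ + 1# * μ ^2^ h + κ * (1# * 1#)                        ≡⟨ cong₂ (λ u v → μ + u + κ * v) (trans (*-identityˡ _) (trans (^2^h μ) σμ)) (*-identityˡ 1#) ⟩
          μ + μ + κ * 1#                                          ≡⟨ cong₂ _+_ (x+x≡0 μ) (*-identityʳ κ) ⟩
          0# + κ                                                  ≡⟨ +-identityˡ κ ⟩
          κ                                                       ∎
        -- Telescoping read backwards: `σ z + z` is the trace of `z * z + z`, which is the trace of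
        -- κ.
        σz : σ z ≡ z + 1#
        σz = begin
          σ z                       ≡⟨ mod-2 z (solve 2 (λ s z → s :+ z :+ z := s :+ (z :+ z)) refl (σ z) z) ⟨
          σ z + z + z               ≡⟨ cong (_+ z) (cong (_+ z) (^2^h z)) ⟨
          z ^2^ h + z + z           ≡⟨ cong (_+ z) (Tr-artin-schreier h z) ⟨
          Tr h (z * z + z) + z      ≡⟨ cong (_+ z) (trans (cong (Tr h) z²+z) Trκ≡1) ⟩
          1# + z                    ≡⟨ +-comm 1# z ⟩
          z + 1#                    ∎

      -- Substituting T = B Z / `σ a` in the quadratic for y₁ and y₂ turns it into Z² + Z = κ, with
      -- roots z and z + 1. Conjugation exchanges these and fixes B, so the norm of either numerator
      -- is their product B² κ, the norm of a.
      even-split : ∀ {a} b → a ≢ 0# → σ b ≢ b → EvenCondition h q a b → Split a b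
      even-split {a} b a≢0 σb≢b Trκ≡1 = record
        { y₁ = y₁ ; y₂ = y₂
        ; norm₁ = norm-from-multiple σa≢0 Ay₁ (trans (cong (_* (B * z)) σ[Bz]) (trans (*-comm _ _) (trans numerators norm-σa)))
        ; norm₂ = norm-from-multiple σa≢0 Ay₂ (trans (cong (_* (B * (z + 1#))) σ[B[z+1]]) (trans numerators norm-σa))
        ; y₁≢y₂ = λ y₁≡y₂ → 0≢1 (sym (begin
            1#                ≡⟨ solve 2 (λ z e → e := (z :+ e) :- z) refl z 1# ⟩
            z + 1# - z        ≡⟨ x≡y⇒x-y≡0 (sym (*-cancelˡ B≢0 (trans (sym Ay₁) (trans (cong (σ a *_) y₁≡y₂) Ay₂)))) ⟩
            0#                ∎))
        ; y₁+y₂ = begin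
            σ a * (y₁ + y₂)             ≡⟨ trans (distribˡ (σ a) y₁ y₂) (cong₂ _+_ Ay₁ Ay₂) ⟩
            B * z + B * (z + 1#)        ≡⟨ mod-2 (B * z) (solve 3 (λ B z e → B :* z :+ B :* (z :+ e) := B :* e :+ (B :* z :+ B :* z)) refl B z 1#) ⟩
            B * 1#                      ≡⟨ *-identityʳ B ⟩
            σ b + b                     ≡⟨ cong (σ b +_) (-x≡x b) ⟨
            σ b - b                     ∎
        ; y₁*y₂ = *-cancelˡ σa≢0 (begin
            σ a * (σ a * (y₁ * y₂))     ≡⟨ solve 3 (λ A u v → A :* (A :* (u :* v)) := (A :* u) :* (A :* v)) refl (σ a) y₁ y₂ ⟩
            σ a * y₁ * (σ a * y₂)       ≡⟨ cong₂ _*_ Ay₁ Ay₂ ⟩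
            B * z * (B * (z + 1#))      ≡⟨ numerators ⟩
            σ a * a                     ≡⟨ cong (σ a *_) (-x≡x a) ⟨
            σ a * - a                   ∎)
        }
        where
        B κ : Carrier
        B = σ b + b
        κ = (a ^ (q ℕ.+ 1)) / (B ^ 2)
        B≢0 : B ≢ 0#
        B≢0 B≡0 = σb≢b (x-y≡0⇒x≡y (trans (cong (σ b +_) (-x≡x b)) B≡0))
        BB≢0 : B * B ≢ 0#
        BB≢0 = x*y≢0 B≢0 B≢0
        BBκ : B * B * κ ≡ σ a * a
        BBκ = trans (cong (B * B *_) (cong₂ _/_ (σ*≡^ a) (^2≡ B))) (*-*⁻¹ (σ a * a) BB≢0)
        σB : σ B ≡ B
        σB = trans (σ-+ (σ b) b) (trans (cong (_+ σ b) (σ-σ b)) (+-comm b (σ b)))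
        -- Since `σ b` is b + B and B is fixed by `σ`, division by B normalises b to an element that
        -- conjugation moves by exactly 1; b outside GF(q) makes B non-zero.
        w : Carrier
        w = b * B ⁻¹
        Bw : B * w ≡ b
        Bw = *-*⁻¹ b B≢0
        σw : σ w ≡ w + 1#
        σw = *-cancelˡ B≢0 (begin
          B * σ w           ≡⟨ cong (_* σ w) σB ⟨
          σ B * σ w         ≡⟨ trans (sym (σ-* B w)) (cong σ Bw) ⟩
          σ b               ≡⟨ mod-2 b (solve 2 (λ b s → b :+ (s :+ b) := s :+ (b :+ b)) refl b (σ b)) ⟨
          b + B             ≡⟨ cong₂ _+_ Bw (*-identityʳ B) ⟨
          B * w + B * 1#    ≡⟨ distribˡ B w 1# ⟨
          B * (w + 1#)      ∎)
        solution : ∃ λ z → z * z + z ≡ κ × σ z ≡ z + 1#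
        solution = artin-schreier-solution Trκ≡1 σw
        z : Carrier
        z = proj₁ solution
        σz : σ z ≡ z + 1#
        σz = proj₂ (proj₂ solution)
        σa≢0 : σ a ≢ 0#
        σa≢0 = σ-≢0 a≢0
        y₁ y₂ : Carrier
        y₁ = (B * z) * σ a ⁻¹
        y₂ = (B * (z + 1#)) * σ a ⁻¹
        Ay₁ : σ a * y₁ ≡ B * z
        Ay₁ = *-*⁻¹ (B * z) σa≢0
        Ay₂ : σ a * y₂ ≡ B * (z + 1#)
        Ay₂ = *-*⁻¹ (B * (z + 1#)) σa≢0
        numerators : B * z * (B * (z + 1#)) ≡ σ a * a
        numerators = begin
          B * z * (B * (z + 1#))    ≡⟨ solve 3 (λ B z e → B :* z :* (B :* (z :+ e)) := B :* B :* (z :* z :+ z :* e)) refl B z 1# ⟩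
          B * B * (z * z + z * 1#)  ≡⟨ cong (λ u → B * B * (z * z + u)) (*-identityʳ z) ⟩
          B * B * (z * z + z)       ≡⟨ cong (B * B *_) (proj₁ (proj₂ solution)) ⟩
          B * B * κ                 ≡⟨ BBκ ⟩
          σ a * a                   ∎
        norm-σa : σ a * a ≡ σ (σ a) * σ a
        norm-σa = trans (*-comm _ _) (cong (_* σ a) (sym (σ-σ a)))
        σ[Bz] : σ (B * z) ≡ B * (z + 1#)
        σ[Bz] = trans (σ-* B z) (cong₂ _*_ σB σz)
        σ[B[z+1]] : σ (B * (z + 1#)) ≡ B * z
        σ[B[z+1]] = begin
          σ (B * (z + 1#))    ≡⟨ cong σ σ[Bz] ⟨
          σ (σ (B * z))       ≡⟨ σ-σ (B * z) ⟩
          B * z               ∎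

-- Value distribution of the sum of forms.

module QuasiHermitian (F : FiniteField) (q : ℕ) (order : SquareOrder F q)
  (a b : FiniteField.Carrier F) (a≢0 : a ≢ FiniteField.0# F) (split : Conjugation.Split F q order a b) where

  open PointSums F
  open SquareOrder order
  open Conjugation F q order
  open QuadraticForm a b a≢0
  open Split split

  formSum : ∀ m → Point m → Carrier
  formSum m w = sumFin m (form ∘ w)

  -- The number of points at which the sum of m forms takes a given non-zero skew value; for
  -- positive m it is q^(2m - 1) - q^(m - 1). The recurrence is what adding one more coordinate
  -- produces.
  offset : ℕ → ℕ
  offset zero    = 0
  offset (suc m) = size ℕ.* offset m ℕ.+ (q ℕ.∸ 1) ℕ.* q ℕ.^ m

  offset-closed : ∀ m → offset (suc m) ℕ.+ q ℕ.^ m ≡ q ℕ.^ (2 ℕ.* m ℕ.+ 1)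
  offset-closed m = trans (step m) (closed m)
    where
    open ≡-Reasoning
    step : ∀ m → offset (suc m) ℕ.+ q ℕ.^ m ≡ size ℕ.* offset m ℕ.+ q ℕ.* q ℕ.^ m
    step m = begin
      size ℕ.* offset m ℕ.+ (q ℕ.∸ 1) ℕ.* q ℕ.^ m ℕ.+ q ℕ.^ m    ≡⟨ ℕ.+-assoc (size ℕ.* offset m) _ _ ⟩
      size ℕ.* offset m ℕ.+ ((q ℕ.∸ 1) ℕ.* q ℕ.^ m ℕ.+ q ℕ.^ m)  ≡⟨ cong (size ℕ.* offset m ℕ.+_) (ℕ.+-comm _ (q ℕ.^ m)) ⟩
      size ℕ.* offset m ℕ.+ (1 ℕ.+ (q ℕ.∸ 1)) ℕ.* q ℕ.^ m        ≡⟨ cong (λ n → size ℕ.* offset m ℕ.+ n ℕ.* q ℕ.^ m) (ℕ.m+[n∸m]≡n (ℕ.≤-trans (s≤s z≤n) 2≤q)) ⟩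
      size ℕ.* offset m ℕ.+ q ℕ.* q ℕ.^ m                        ∎
    closed : ∀ m → size ℕ.* offset m ℕ.+ q ℕ.* q ℕ.^ m ≡ q ℕ.^ (2 ℕ.* m ℕ.+ 1)
    closed zero    = cong (ℕ._+ q ℕ.* 1) (ℕ.*-zeroʳ size)
    closed (suc m) = begin
      size ℕ.* offset (suc m) ℕ.+ q ℕ.* (q ℕ.* q ℕ.^ m)          ≡⟨ cong₂ ℕ._+_ (cong (ℕ._* offset (suc m)) size≡q*q) (sym (ℕ.*-assoc q q _)) ⟩
      q ℕ.* q ℕ.* offset (suc m) ℕ.+ q ℕ.* q ℕ.* q ℕ.^ m         ≡⟨ ℕ.*-distribˡ-+ (q ℕ.* q) (offset (suc m)) (q ℕ.^ m) ⟨
      q ℕ.* q ℕ.* (offset (suc m) ℕ.+ q ℕ.^ m)                   ≡⟨ cong (q ℕ.* q ℕ.*_) (trans (step m) (closed m)) ⟩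
      q ℕ.* q ℕ.* q ℕ.^ (2 ℕ.* m ℕ.+ 1)                          ≡⟨ ℕ.*-assoc q q _ ⟩
      q ℕ.^ (2 ℕ.+ (2 ℕ.* m ℕ.+ 1))                              ≡⟨ cong (q ℕ.^_) (cong (ℕ._+ 1) (sym (ℕ.*-suc 2 m))) ⟩
      q ℕ.^ (2 ℕ.* suc m ℕ.+ 1)                                  ∎

  skew-- : ∀ {u v} → σ u ≡ - u → σ v ≡ - v → σ (u - v) ≡ - (u - v)
  skew-- {u} {v} σu σv = trans (σ-- u v) (trans (cong₂ _-_ σu σv)
    (solve 2 (λ u v → (:- u) :- (:- v) := :- (u :- v)) refl u v))

  translated-form-fibre : ∀ v c → σ c ≡ - c → ∑ (λ x → [ form (x + v) ≟ c ]) ≡ (q ℕ.∸ 1) ℕ.+ q ℕ.* [ c ≟ 0# ]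
  translated-form-fibre v c c-skew = trans
    (sym (∑-reindex (λ x → [ form x ≟ c ]) (_+ v) (_- v)
      (λ x → solve 2 (λ x v → (x :- v) :+ v := x) refl x v) (λ x → solve 2 (λ x v → (x :+ v) :- v := x) refl x v)))
    (form-fibre split c c-skew)

  -- Fixing the first coordinate leaves a fibre over another skew value. The constant part of the
  -- induction hypothesis contributes once for every field element, and the brackets add up to a
  -- fibre of the single form over c.
  formSum-fibre : ∀ m (v : Point m) c → σ c ≡ - c →
                  ∑ᴾ m (λ w → [ formSum m (λ i → w i + v i) ≟ c ]) ≡ offset m ℕ.+ q ℕ.^ m ℕ.* [ c ≟ 0# ]
  formSum-fibre zero    v c c-skew = trans ([]-⇔ (0# ≟ c) (c ≟ 0#) sym sym) (sym (ℕ.*-identityˡ _))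
  formSum-fibre (suc m) v c c-skew = begin
    ∑ (λ x → ∑ᴾ m (λ w → [ (f₀ x + rest w) ≟ c ]))                      ≡⟨ ∑-cong (λ x → ∑ᴾ-cong m λ w → []-⇔ ((f₀ x + rest w) ≟ c) (rest w ≟ (c - f₀ x))
                                                                             (λ eq → trans (solve 2 (λ u e → e := (u :+ e) :- u) refl (f₀ x) (rest w)) (cong (_- f₀ x) eq))
                                                                             (λ eq → trans (cong (f₀ x +_) eq) (solve 2 (λ u d → u :+ (d :- u) := d) refl (f₀ x) c))) ⟩
    ∑ (λ x → ∑ᴾ m (λ w → [ rest w ≟ (c - f₀ x) ]))                      ≡⟨ ∑-cong (λ x → formSum-fibre m (v ∘ suc) (c - f₀ x) (skew-- c-skew (form-skew _))) ⟩
    ∑ (λ x → offset m ℕ.+ q ℕ.^ m ℕ.* [ (c - f₀ x) ≟ 0# ])              ≡⟨ ∑-+ (λ _ → offset m) (λ x → q ℕ.^ m ℕ.* [ (c - f₀ x) ≟ 0# ]) ⟩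
    ∑ (λ _ → offset m) ℕ.+ ∑ (λ x → q ℕ.^ m ℕ.* [ (c - f₀ x) ≟ 0# ])    ≡⟨ cong₂ ℕ._+_ (∑-const (offset m)) (∑-*ˡ (q ℕ.^ m) (λ x → [ (c - f₀ x) ≟ 0# ])) ⟩
    size ℕ.* offset m ℕ.+ q ℕ.^ m ℕ.* ∑ (λ x → [ (c - f₀ x) ≟ 0# ])     ≡⟨ cong (λ n → size ℕ.* offset m ℕ.+ q ℕ.^ m ℕ.* n) (∑-cong λ x →
                                                                             []-⇔ ((c - f₀ x) ≟ 0#) (f₀ x ≟ c) (sym ∘ x-y≡0⇒x≡y) (x≡y⇒x-y≡0 ∘ sym)) ⟩
    size ℕ.* offset m ℕ.+ q ℕ.^ m ℕ.* ∑ (λ x → [ f₀ x ≟ c ])            ≡⟨ cong (λ n → size ℕ.* offset m ℕ.+ q ℕ.^ m ℕ.* n) (translated-form-fibre (v zero) c c-skew) ⟩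
    size ℕ.* offset m ℕ.+ q ℕ.^ m ℕ.* ((q ℕ.∸ 1) ℕ.+ q ℕ.* [ c ≟ 0# ])  ≡⟨ regroup (q ℕ.∸ 1) [ c ≟ 0# ] ⟩
    offset (suc m) ℕ.+ q ℕ.^ suc m ℕ.* [ c ≟ 0# ]                       ∎
    where
    open ≡-Reasoning
    f₀ : Carrier → Carrier
    f₀ x = form (x + v zero)
    rest : Point m → Carrier
    rest w = formSum m (λ i → w i + v (suc i))
    regroup : ∀ p i → size ℕ.* offset m ℕ.+ q ℕ.^ m ℕ.* (p ℕ.+ q ℕ.* i) ≡
                      size ℕ.* offset m ℕ.+ p ℕ.* q ℕ.^ m ℕ.+ q ℕ.* q ℕ.^ m ℕ.* i
    regroup p i = begin
      size ℕ.* offset m ℕ.+ Q ℕ.* (p ℕ.+ q ℕ.* i)               ≡⟨ cong (size ℕ.* offset m ℕ.+_) (ℕ.*-distribˡ-+ Q p (q ℕ.* i)) ⟩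
      size ℕ.* offset m ℕ.+ (Q ℕ.* p ℕ.+ Q ℕ.* (q ℕ.* i))       ≡⟨ cong₂ (λ u v → size ℕ.* offset m ℕ.+ (u ℕ.+ v)) (ℕ.*-comm Q p)
                                                                     (trans (sym (ℕ.*-assoc Q q i)) (cong (ℕ._* i) (ℕ.*-comm Q q))) ⟩
      size ℕ.* offset m ℕ.+ (p ℕ.* Q ℕ.+ q ℕ.* Q ℕ.* i)         ≡⟨ ℕ.+-assoc (size ℕ.* offset m) (p ℕ.* Q) _ ⟨
      size ℕ.* offset m ℕ.+ p ℕ.* Q ℕ.+ q ℕ.* Q ℕ.* i           ∎
      where Q = q ℕ.^ m

  -- The map from y to its conjugate minus y, and the polar form.

  D : Carrier → Carrier
  D y = σ y - y

  D-+ : ∀ x y → D (x + y) ≡ D x + D y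
  D-+ x y = trans (cong (_- (x + y)) (σ-+ x y))
    (solve 4 (λ x y s t → (s :+ t) :- (x :+ y) := (s :- x) :+ (t :- y)) refl x y (σ x) (σ y))

  D-sum : ∀ m (t : Point m) → D (sumFin m t) ≡ sumFin m (D ∘ t)
  D-sum zero    t = trans (cong (_- 0#) σ-0) (-‿inverseʳ 0#)
  D-sum (suc m) t = trans (D-+ _ _) (cong (D (t zero) +_) (D-sum m (t ∘ suc)))

  D-skew : ∀ x → σ (D x) ≡ - D x
  D-skew x = trans (σ-- (σ x) x) (trans (cong (_- σ x) (σ-σ x)) (solve 2 (λ x s → x :- s := :- (s :- x)) refl x (σ x)))

  -- The case y = 1 of `linear-fibre`, whose condition on the value u is then skewness.
  D-fibre : ∀ {u} → σ u ≡ - u → ∑ (λ x → [ D x ≟ u ]) ≡ q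
  D-fibre {u} u-skew = begin
    ∑ (λ x → [ D x ≟ u ])               ≡⟨ ∑-cong (λ x → cong (λ z → [ (σ x - z) ≟ u ]) (sym (*-identityˡ x))) ⟩
    ∑ (λ x → [ (σ x - 1# * x) ≟ u ])    ≡⟨ linear-fibre (trans (cong (_* 1#) σ1) (*-identityˡ 1#)) u ⟩
    q ℕ.* [ σ u ≟ (- σ 1# * u) ]        ≡⟨ cong (q ℕ.*_) ([]-yes (σ u ≟ (- σ 1# * u)) (trans u-skew
                                             (trans (cong (-_) (sym (*-identityˡ u))) (trans (solve 2 (λ e u → :- (e :* u) := (:- e) :* u) refl 1# u)
                                               (cong (λ z → - z * u) (sym σ1)))))) ⟩
    q ℕ.* 1                             ≡⟨ ℕ.*-identityʳ q ⟩
    q                                   ∎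
    where
    open ≡-Reasoning
    σ1 : σ 1# ≡ 1#
    σ1 = 1^n q
      where
      1^n : ∀ n → 1# ^ n ≡ 1#
      1^n zero    = refl
      1^n (suc n) = trans (*-identityˡ _) (1^n n)

  formSum-skew : ∀ m w → σ (formSum m w) ≡ - formSum m w
  formSum-skew zero    w = trans σ-0 (sym -0#≈0#)
  formSum-skew (suc m) w = trans (σ-+ _ _) (trans (cong₂ _+_ (form-skew (w zero)) (formSum-skew m (w ∘ suc)))
    (solve 2 (λ u v → (:- u) :+ (:- v) := :- (u :+ v)) refl _ _))

  -- The derivative of the form: form (x + v) - form x - form v = D (slope v * x).
  slope : Carrier → Carrier
  slope v = a * v + a * v + β * σ v

  σ-slope : ∀ v → σ (slope v) ≡ σ a * σ v + σ a * σ v - β * v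
  σ-slope v = begin
    σ (a * v + a * v + β * σ v)             ≡⟨ trans (σ-+ _ _) (cong (_+ σ (β * σ v)) (σ-+ _ _)) ⟩
    σ (a * v) + σ (a * v) + σ (β * σ v)     ≡⟨ cong₂ (λ y z → y + y + z) (σ-* a v) (trans (σ-* β (σ v)) (cong₂ _*_ σβ (σ-σ v))) ⟩
    σ a * σ v + σ a * σ v + - β * v         ≡⟨ solve 4 (λ A V β v → A :* V :+ A :* V :+ (:- β) :* v := A :* V :+ A :* V :- β :* v)
                                                 refl (σ a) (σ v) β v ⟩
    σ a * σ v + σ a * σ v - β * v           ∎
    where open ≡-Reasoning

  form-+ : ∀ x v → form (x + v) ≡ form x + form v + D (slope v * x)
  form-+ x v = begin
    form (x + v)                                                                ≡⟨ form-σ (x + v) ⟩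
    σ a * (σ (x + v) * σ (x + v)) - a * ((x + v) * (x + v)) - β * (σ (x + v) * (x + v))
                                                                                ≡⟨ cong (λ s → σ a * (s * s) - a * ((x + v) * (x + v)) - β * (s * (x + v))) (σ-+ x v) ⟩
    σ a * ((X + V) * (X + V)) - a * ((x + v) * (x + v)) - β * ((X + V) * (x + v))
                                                                                ≡⟨ solve 7 (λ A a β x v X V →
      A :* ((X :+ V) :* (X :+ V)) :- a :* ((x :+ v) :* (x :+ v)) :- β :* ((X :+ V) :* (x :+ v)) :=
      (A :* (X :* X) :- a :* (x :* x) :- β :* (X :* x)) :+ (A :* (V :* V) :- a :* (v :* v) :- β :* (V :* v))
      :+ ((A :* V :+ A :* V :- β :* v) :* X :- (a :* v :+ a :* v :+ β :* V) :* x)) refl (σ a) a β x v X V ⟩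
    (σ a * (X * X) - a * (x * x) - β * (X * x)) + (σ a * (V * V) - a * (v * v) - β * (V * v))
      + ((σ a * V + σ a * V - β * v) * X - slope v * x)                         ≡⟨ cong₂ _+_ (cong₂ _+_ (form-σ x) (form-σ v))
                                                                                     (cong (_- slope v * x) (trans (σ-* (slope v) x) (cong (_* X) (σ-slope v)))) ⟨
    form x + form v + D (slope v * x)                                           ∎
    where
    open ≡-Reasoning
    X = σ x
    V = σ v

  -- The determinant of `slope v ≡ μ` and its conjugate equation, read as a linear system in v and
  -- `σ v`. It is also the quantity 4 a^(q+1) + (b^q - b)² of the odd condition.
  discriminant : Carrier
  discriminant = a * σ a + a * σ a + (a * σ a + a * σ a) + β * β

  -- By Vieta it is the discriminant of the quadratic with roots y₁ and y₂, hence the square of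
  -- `σ a * (y₁ - y₂)`. The argument is the same in every characteristic.
  discriminant≢0 : discriminant ≢ 0#
  discriminant≢0 Δ≡0 = x*y≢0 σaδ≢0 σaδ≢0 (trans square Δ≡0)
    where
    open ≡-Reasoning
    σaδ≢0 : σ a * (y₁ - y₂) ≢ 0#
    σaδ≢0 = x*y≢0 (σ-≢0 a≢0) (y₁≢y₂ ∘ x-y≡0⇒x≡y)
    square : σ a * (y₁ - y₂) * (σ a * (y₁ - y₂)) ≡ discriminant
    square = begin
      σ a * (y₁ - y₂) * (σ a * (y₁ - y₂))     ≡⟨ solve 3 (λ A u v → A :* (u :- v) :* (A :* (u :- v)) :=
                                                   (A :* (u :+ v)) :* (A :* (u :+ v)) :-
                                                   ((A :* (u :* v)) :* A :+ (A :* (u :* v)) :* A :+ ((A :* (u :* v)) :* A :+ (A :* (u :* v)) :* A)))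
                                                   refl (σ a) y₁ y₂ ⟩
      σ a * (y₁ + y₂) * (σ a * (y₁ + y₂)) - (p * σ a + p * σ a + (p * σ a + p * σ a))
                                              ≡⟨ cong₂ (λ s p → s * s - (p * σ a + p * σ a + (p * σ a + p * σ a))) y₁+y₂ y₁*y₂ ⟩
      β * β - (- a * σ a + - a * σ a + (- a * σ a + - a * σ a))
                                              ≡⟨ solve 3 (λ a A β → β :* β :- ((:- a) :* A :+ (:- a) :* A :+ ((:- a) :* A :+ (:- a) :* A)) :=
                                                   a :* A :+ a :* A :+ (a :* A :+ a :* A) :+ β :* β) refl a (σ a) β ⟩
      discriminant                            ∎
      where p = σ a * (y₁ * y₂)

  σ-discriminant : σ discriminant ≡ discriminant
  σ-discriminant = begin
    σ (N + N + (N + N) + β * β)                 ≡⟨ trans (σ-+ _ _) (cong₂ _+_ (trans (σ-+ _ _) (cong₂ _+_ (σ-+ N N) (σ-+ N N))) (σ-* β β)) ⟩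
    σ N + σ N + (σ N + σ N) + σ β * σ β         ≡⟨ cong₂ (λ n s → n + n + (n + n) + s * s) (trans (σ-* a (σ a)) (trans (cong (σ a *_) (σ-σ a)) (*-comm _ _))) σβ ⟩
    N + N + (N + N) + - β * - β                 ≡⟨ solve 2 (λ N β → N :+ N :+ (N :+ N) :+ (:- β) :* (:- β) := N :+ N :+ (N :+ N) :+ β :* β) refl N β ⟩
    discriminant                                ∎
    where
    open ≡-Reasoning
    N = a * σ a

  -- Cramer's rule with v and `σ v` as unknowns: `n` is the numerator for v, and since the
  -- determinant is fixed by `σ`, the conjugate of `n` is the numerator for `σ v`.
  slope-surjective : ∀ μ → ∃ λ v → slope v ≡ μ
  slope-surjective μ = v , *-cancelˡ discriminant≢0 (begin
    Δ * (a * v + a * v + β * σ v)                       ≡⟨ solve 5 (λ Δ a v β s → Δ :* (a :* v :+ a :* v :+ β :* s) := a :* (Δ :* v) :+ a :* (Δ :* v) :+ β :* (Δ :* s))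
                                                             refl Δ a v β (σ v) ⟩
    a * (Δ * v) + a * (Δ * v) + β * (Δ * σ v)           ≡⟨ cong₂ (λ y z → a * y + a * y + β * z) Δv Δσv ⟩
    a * n + a * n + β * (a * σ μ + a * σ μ + β * μ)     ≡⟨ solve 5 (λ a A β μ s →
                                                             a :* (A :* μ :+ A :* μ :- β :* s) :+ a :* (A :* μ :+ A :* μ :- β :* s) :+ β :* (a :* s :+ a :* s :+ β :* μ) :=
                                                             (a :* A :+ a :* A :+ (a :* A :+ a :* A) :+ β :* β) :* μ) refl a (σ a) β μ (σ μ) ⟩
    Δ * μ                                               ∎)
    where
    open ≡-Reasoning
    Δ = discriminant
    n = σ a * μ + σ a * μ - β * σ μ
    v = n * Δ ⁻¹
    Δv : Δ * v ≡ n
    Δv = trans (solve 3 (λ d n i → d :* (n :* i) := n :* (d :* i)) refl Δ n (Δ ⁻¹))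
               (trans (cong (n *_) (⁻¹-inverse Δ discriminant≢0)) (*-identityʳ n))
    Δσv : Δ * σ v ≡ a * σ μ + a * σ μ + β * μ
    Δσv = begin
      Δ * σ v                                           ≡⟨ cong (_* σ v) σ-discriminant ⟨
      σ Δ * σ v                                         ≡⟨ trans (sym (σ-* Δ v)) (cong σ Δv) ⟩
      σ (σ a * μ + σ a * μ - β * σ μ)                   ≡⟨ trans (σ-- _ _) (cong₂ _-_ (σ-+ _ _) (trans (σ-* β (σ μ)) (cong₂ _*_ σβ (σ-σ μ)))) ⟩
      σ (σ a * μ) + σ (σ a * μ) - - β * μ               ≡⟨ cong (λ z → z + z - - β * μ) (trans (σ-* (σ a) μ) (cong (_* σ μ) (σ-σ a))) ⟩
      a * σ μ + a * σ μ - - β * μ                       ≡⟨ solve 4 (λ a s β μ → a :* s :+ a :* s :- (:- β) :* μ := a :* s :+ a :* s :+ β :* μ) refl a (σ μ) β μ ⟩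
      a * σ μ + a * σ μ + β * μ                         ∎

  -- Points of B(a,b) and its hyperplane sections.

  quasi : ∀ m → PointSet (suc m)
  quasi m = Bset q a b (suc m)

  incident : ∀ m → Point m → Carrier → ℕ
  incident m w y = [ (D y + formSum m w) ≟ 0# ]

  incident-cong : ∀ m {w w′ y y′} → w ≗ w′ → y ≡ y′ → incident m w y ≡ incident m w′ y′
  incident-cong m w≗w′ refl = cong (λ s → [ (D _ + s) ≟ 0# ]) (sumFin-cong m (cong form ∘ w≗w′))

  indicator-quasi : ∀ m x → indicator (quasi m x) ≡ incident m (x ∘ inject₁) (x (fromℕ m))
  indicator-quasi m x = []-⇔ (lhs ≟ rhs) ((D xᵣ + formSum m w) ≟ 0#)
    (λ eq → trans (sym lhs-rhs) (x≡y⇒x-y≡0 eq)) (λ eq → x-y≡0⇒x≡y (trans lhs-rhs eq))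
    where
    open ≡-Reasoning
    xᵣ = x (fromℕ m)
    w : Point m
    w = x ∘ inject₁
    S₁ = sumFin m (λ i → w i ^ (2 ℕ.* q))
    S₂ = sumFin m (λ i → w i ^ 2)
    S₃ = sumFin m (λ i → w i ^ (q ℕ.+ 1))
    lhs = xᵣ ^ q - xᵣ + a ^ q * S₁ - a * S₂
    rhs = (b ^ q - b) * S₃
    formSum≡ : formSum m w ≡ σ a * S₁ - a * S₂ - β * S₃
    formSum≡ = begin
      formSum m w
        ≡⟨ sumFin-- m (λ i → σ a * w i ^ (2 ℕ.* q) - a * w i ^ 2) (λ i → β * w i ^ (q ℕ.+ 1)) ⟩
      sumFin m (λ i → σ a * w i ^ (2 ℕ.* q) - a * w i ^ 2) - sumFin m (λ i → β * w i ^ (q ℕ.+ 1))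
        ≡⟨ cong₂ _-_ (sumFin-- m (λ i → σ a * w i ^ (2 ℕ.* q)) (λ i → a * w i ^ 2)) (sumFin-*ˡ m β (λ i → w i ^ (q ℕ.+ 1))) ⟩
      sumFin m (λ i → σ a * w i ^ (2 ℕ.* q)) - sumFin m (λ i → a * w i ^ 2) - β * S₃
        ≡⟨ cong₂ (λ s t → s - t - β * S₃) (sumFin-*ˡ m (σ a) (λ i → w i ^ (2 ℕ.* q))) (sumFin-*ˡ m a (λ i → w i ^ 2)) ⟩
      σ a * S₁ - a * S₂ - β * S₃  ∎
    lhs-rhs : lhs - rhs ≡ D xᵣ + formSum m w
    lhs-rhs = begin
      D xᵣ + σ a * S₁ - a * S₂ - β * S₃
        ≡⟨ solve 4 (λ d s t u → d :+ s :- t :- u := d :+ (s :- t :- u)) refl (D xᵣ) (σ a * S₁) (a * S₂) (β * S₃) ⟩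
      D xᵣ + (σ a * S₁ - a * S₂ - β * S₃)   ≡⟨ cong (D xᵣ +_) formSum≡ ⟨
      D xᵣ + formSum m w                    ∎

  -- The last coordinate solves `D y ≡ - s`, and the right-hand side is skew because every value of
  -- the form is.
  incident-fibre : ∀ m w → ∑ (incident m w) ≡ q
  incident-fibre m w = trans
    (∑-cong λ y → []-⇔ ((D y + s) ≟ 0#) (D y ≟ (- s))
      (λ eq → trans (solve 2 (λ d s → d := (d :+ s) :- s) refl (D y) s) (trans (cong (_- s) eq) (+-identityˡ _)))
      (λ eq → trans (cong (_+ s) eq) (-‿inverseˡ s)))
    (D-fibre (trans (σ-‿- s) (cong (-_) (formSum-skew m w))))
    where s = formSum m w

  quasi-count : ∀ m → count (suc m) (quasi m) ≡ size ℕ.^ m ℕ.* q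
  quasi-count m = begin
    count (suc m) (quasi m)                                               ≡⟨ count-∑ᴾ (suc m) (quasi m) ⟩
    ∑ᴾ (suc m) (indicator ∘ quasi m)                                      ≡⟨ ∑ᴾ-cong (suc m) (indicator-quasi m) ⟩
    ∑ᴾ (suc m) g                                                          ≡⟨ ∑ᴾ-snoc m g (λ x≗ → incident-cong m (x≗ ∘ inject₁) (x≗ (fromℕ m))) ⟩
    ∑ᴾ m (λ w → ∑ (λ y → g (snoc w y)))                                   ≡⟨ ∑ᴾ-cong m (λ w → trans
                                                                               (∑-cong λ y → incident-cong m (snoc-inject₁ w y) (snoc-fromℕ w y))
                                                                               (incident-fibre m w)) ⟩
    ∑ᴾ m (λ w → q)                                                        ≡⟨ ∑ᴾ-const m q ⟩
    size ℕ.^ m ℕ.* q                                                      ∎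
    where
    open ≡-Reasoning
    g : Point (suc m) → ℕ
    g x = incident m (x ∘ inject₁) (x (fromℕ m))

  indicator-∧ : ∀ s t → indicator (s ∧ t) ≡ indicator s ℕ.* indicator t
  indicator-∧ true  t = sym (ℕ.*-identityˡ _)
  indicator-∧ false t = refl

  module _ {m} (H : Hyperplane (suc m)) where
    open Hyperplane H

    cᵣ : Carrier
    cᵣ = coeff (fromℕ m)

    linear : Point m → Carrier
    linear w = sumFin m (λ i → coeff (inject₁ i) * w i)

    meetCount-∑ᴾ : meetCount H (quasi m) ≡ ∑ᴾ m (λ w → ∑ (λ y → [ (linear w + cᵣ * y) ≟ const ] ℕ.* incident m w y))
    meetCount-∑ᴾ = begin
      meetCount H (quasi m)                                     ≡⟨ count-∑ᴾ (suc m) (λ x → onHyperplane H x ∧ quasi m x) ⟩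
      ∑ᴾ (suc m) (λ x → indicator (onHyperplane H x ∧ quasi m x)) ≡⟨ ∑ᴾ-cong (suc m) (λ x → trans (indicator-∧ (onHyperplane H x) (quasi m x))
                                                                        (cong (indicator (onHyperplane H x) ℕ.*_) (indicator-quasi m x))) ⟩
      ∑ᴾ (suc m) g                                              ≡⟨ ∑ᴾ-snoc m g g-cong ⟩
      ∑ᴾ m (λ w → ∑ (λ y → g (snoc w y)))                       ≡⟨ ∑ᴾ-cong m (λ w → ∑-cong λ y → cong₂ (λ s n → [ s ≟ const ] ℕ.* n)
                                                                     (split-last w y) (incident-cong m (snoc-inject₁ w y) (snoc-fromℕ w y))) ⟩
      ∑ᴾ m (λ w → ∑ (λ y → [ (linear w + cᵣ * y) ≟ const ] ℕ.* incident m w y))  ∎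
      where
      open ≡-Reasoning
      g : Point (suc m) → ℕ
      g x = [ sumFin (suc m) (λ i → coeff i * x i) ≟ const ] ℕ.* incident m (x ∘ inject₁) (x (fromℕ m))
      g-cong : ∀ {x x′} → x ≗ x′ → g x ≡ g x′
      g-cong x≗ = cong₂ (λ s n → [ s ≟ const ] ℕ.* n) (sumFin-cong (suc m) λ i → cong (coeff i *_) (x≗ i))
                        (incident-cong m (x≗ ∘ inject₁) (x≗ (fromℕ m)))
      split-last : ∀ w y → sumFin (suc m) (λ i → coeff i * snoc w y i) ≡ linear w + cᵣ * y
      split-last w y = trans (sumFin-snoc m (λ i → coeff i * snoc w y i))
        (cong₂ _+_ (sumFin-cong m λ i → cong (coeff (inject₁ i) *_) (snoc-inject₁ w y i)) (cong (cᵣ *_) (snoc-fromℕ w y)))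

    -- A hyperplane x_r = e + Σ slope (v i) * x_i; translation by v absorbs the linear terms.
    graph-meetCount : (v : Point m) (e : Carrier) → cᵣ ≢ 0# → (∀ i → coeff (inject₁ i) ≡ - (cᵣ * slope (v i))) → const ≡ cᵣ * e →
                      meetCount H (quasi m) ≡ offset m ℕ.+ q ℕ.^ m ℕ.* [ (formSum m v - D e) ≟ 0# ]
    graph-meetCount v e cᵣ≢0 coeff≡ const≡ = begin
      meetCount H (quasi m)                                           ≡⟨ meetCount-∑ᴾ ⟩
      ∑ᴾ m (λ w → ∑ (λ y → [ (linear w + cᵣ * y) ≟ const ] ℕ.* incident m w y))
                                                                      ≡⟨ ∑ᴾ-cong m (λ w → ∑-cong λ y → cong (ℕ._* incident m w y) (on-graph w y)) ⟩
      ∑ᴾ m (λ w → ∑ (λ y → [ y ≟ height w ] ℕ.* incident m w y))      ≡⟨ ∑ᴾ-cong m (λ w → ∑-[≡]-* (height w) (incident m w)) ⟩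
      ∑ᴾ m (λ w → incident m w (height w))                            ≡⟨ ∑ᴾ-cong m (λ w → []-⇔ ((D (height w) + formSum m w) ≟ 0#) (translated w ≟ c)
                                                                           (λ eq → x-y≡0⇒x≡y (trans (sym (completed w)) eq)) (λ eq → trans (completed w) (x≡y⇒x-y≡0 eq))) ⟩
      ∑ᴾ m (λ w → [ translated w ≟ c ])                               ≡⟨ formSum-fibre m v c (skew-- (formSum-skew m v) (D-skew e)) ⟩
      offset m ℕ.+ q ℕ.^ m ℕ.* [ c ≟ 0# ]                             ∎
      where
      open ≡-Reasoning
      c = formSum m v - D e
      tilt height translated : Point m → Carrier
      tilt w = sumFin m (λ i → slope (v i) * w i)
      height w = e + tilt w
      translated w = formSum m (λ i → w i + v i)
      linear≡ : ∀ w → linear w ≡ - (cᵣ * tilt w)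
      linear≡ w = begin
        linear w                                            ≡⟨ sumFin-cong m (λ i → trans (cong (_* w i) (coeff≡ i))
                                                                 (solve 3 (λ c s x → (:- (c :* s)) :* x := :- (c :* (s :* x))) refl cᵣ (slope (v i)) (w i))) ⟩
        sumFin m (λ i → - (cᵣ * (slope (v i) * w i)))       ≡⟨ sumFin-neg m (λ i → cᵣ * (slope (v i) * w i)) ⟩
        - sumFin m (λ i → cᵣ * (slope (v i) * w i))         ≡⟨ cong (-_) (sumFin-*ˡ m cᵣ (λ i → slope (v i) * w i)) ⟩
        - (cᵣ * tilt w)                                     ∎
      on-graph : ∀ w y → [ (linear w + cᵣ * y) ≟ const ] ≡ [ y ≟ height w ]
      on-graph w y = []-⇔ ((linear w + cᵣ * y) ≟ const) (y ≟ height w)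
        (λ eq → *-cancelˡ cᵣ≢0 (begin
          cᵣ * y                                  ≡⟨ solve 2 (λ l y → y := (l :+ y) :- l) refl (linear w) (cᵣ * y) ⟩
          linear w + cᵣ * y - linear w            ≡⟨ cong₂ _-_ (trans eq const≡) (linear≡ w) ⟩
          cᵣ * e - - (cᵣ * tilt w)                ≡⟨ solve 3 (λ c e t → c :* e :- (:- (c :* t)) := c :* (e :+ t)) refl cᵣ e (tilt w) ⟩
          cᵣ * height w                           ∎))
        (λ eq → begin
          linear w + cᵣ * y                       ≡⟨ cong₂ (λ l y → l + cᵣ * y) (linear≡ w) eq ⟩
          - (cᵣ * tilt w) + cᵣ * (e + tilt w)     ≡⟨ solve 3 (λ c e t → (:- (c :* t)) :+ c :* (e :+ t) := c :* e) refl cᵣ e (tilt w) ⟩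
          cᵣ * e                                  ≡⟨ const≡ ⟨
          const                                   ∎)
      completed : ∀ w → D (height w) + formSum m w ≡ translated w - c
      completed w = begin
        D (e + tilt w) + formSum m w                ≡⟨ cong (_+ formSum m w) (trans (D-+ e (tilt w)) (cong (D e +_) (D-sum m _))) ⟩
        D e + T + formSum m w                       ≡⟨ solve 4 (λ d t f g → d :+ t :+ f := f :+ g :+ t :- (g :- d)) refl (D e) T (formSum m w) (formSum m v) ⟩
        formSum m w + formSum m v + T - c           ≡⟨ cong (λ z → z + T - c) (sumFin-+ m (form ∘ w) (form ∘ v)) ⟨
        sumFin m (λ i → form (w i) + form (v i)) + T - c
                                                    ≡⟨ cong (_- c) (sumFin-+ m (λ i → form (w i) + form (v i)) (λ i → D (slope (v i) * w i))) ⟨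
        sumFin m (λ i → form (w i) + form (v i) + D (slope (v i) * w i)) - c
                                                    ≡⟨ cong (_- c) (sumFin-cong m λ i → form-+ (w i) (v i)) ⟨
        translated w - c                            ∎
        where T = sumFin m (λ i → D (slope (v i) * w i))

    vertical-meetCount : cᵣ ≡ 0# → ∀ {k} → m ≡ suc k → meetCount H (quasi m) ≡ size ℕ.^ k ℕ.* q
    vertical-meetCount cᵣ≡0 {k} refl with nonzero
    ... | i , cᵢ≢0 with view i
    -- The last coefficient vanishes, so the non-zero one belongs to the equation of the base.
    ...   | ‵fromℕ     = ⊥-elim (cᵢ≢0 cᵣ≡0)
    ...   | ‵inject₁ j = begin
      meetCount H (quasi m)                                           ≡⟨ meetCount-∑ᴾ ⟩
      ∑ᴾ m (λ w → ∑ (λ y → [ (linear w + cᵣ * y) ≟ const ] ℕ.* incident m w y))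
                                                                      ≡⟨ ∑ᴾ-cong m (λ w → trans (∑-cong λ y → cong (λ s → [ s ≟ const ] ℕ.* incident m w y) (no-last w y))
                                                                           (trans (∑-*ˡ [ linear w ≟ const ] (incident m w)) (cong ([ linear w ≟ const ] ℕ.*_) (incident-fibre m w)))) ⟩
      ∑ᴾ m (λ w → [ linear w ≟ const ] ℕ.* q)                         ≡⟨ ∑ᴾ-*ʳ m (λ w → [ linear w ≟ const ]) q ⟩
      ∑ᴾ m (λ w → [ linear w ≟ const ]) ℕ.* q                         ≡⟨ cong (ℕ._* q) (linear-solutions k (coeff ∘ inject₁) j cᵢ≢0 const) ⟩
      size ℕ.^ k ℕ.* q                                                ∎
      where
      open ≡-Reasoning
      no-last : ∀ w y → linear w + cᵣ * y ≡ linear w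
      no-last w y = trans (cong (λ c → linear w + c * y) cᵣ≡0) (trans (cong (linear w +_) (zeroˡ y)) (+-identityʳ _))

    -- After division by `cᵣ`, every coefficient is the slope of some translation, because `slope`
    -- is onto.
    graph-shape : cᵣ ≢ 0# → ∃ λ v → ∃ λ e → (∀ i → coeff (inject₁ i) ≡ - (cᵣ * slope (v i))) × const ≡ cᵣ * e
    graph-shape cᵣ≢0 = proj₁ ∘ preimage , cᵣ ⁻¹ * const , coeff≡ , sym (cancel const)
      where
      open ≡-Reasoning
      cancel : ∀ x → cᵣ * (cᵣ ⁻¹ * x) ≡ x
      cancel x = trans (sym (*-assoc _ _ x)) (trans (cong (_* x) (⁻¹-inverse cᵣ cᵣ≢0)) (*-identityˡ x))
      preimage : ∀ i → ∃ λ v → slope v ≡ cᵣ ⁻¹ * - coeff (inject₁ i)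
      preimage i = slope-surjective (cᵣ ⁻¹ * - coeff (inject₁ i))
      coeff≡ : ∀ i → coeff (inject₁ i) ≡ - (cᵣ * slope (proj₁ (preimage i)))
      coeff≡ i = begin
        coeff (inject₁ i)                             ≡⟨ solve 1 (λ c → c := :- (:- c)) refl _ ⟩
        - - coeff (inject₁ i)                         ≡⟨ cong (-_) (cancel (- coeff (inject₁ i))) ⟨
        - (cᵣ * (cᵣ ⁻¹ * - coeff (inject₁ i)))        ≡⟨ cong (λ s → - (cᵣ * s)) (proj₂ (preimage i)) ⟨
        - (cᵣ * slope (proj₁ (preimage i)))           ∎

    meetCount-cases : ∀ {k} → m ≡ suc k →
      meetCount H (quasi m) ≡ offset m ⊎ meetCount H (quasi m) ≡ size ℕ.^ k ℕ.* q ⊎ meetCount H (quasi m) ≡ offset m ℕ.+ q ℕ.^ m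
    meetCount-cases {k} m≡ = case-cᵣ (cᵣ ≟ 0#)
      where
      Cases : ℕ → Set
      Cases n = n ≡ offset m ⊎ n ≡ size ℕ.^ k ℕ.* q ⊎ n ≡ offset m ℕ.+ q ℕ.^ m
      case-c : ∀ {P : Set} (d : Dec P) → Cases (offset m ℕ.+ q ℕ.^ m ℕ.* [ d ])
      case-c (yes _) = inj₂ (inj₂ (cong (offset m ℕ.+_) (ℕ.*-identityʳ (q ℕ.^ m))))
      case-c (no _)  = inj₁ (trans (cong (offset m ℕ.+_) (ℕ.*-zeroʳ (q ℕ.^ m))) (ℕ.+-identityʳ _))
      case-cᵣ : Dec (cᵣ ≡ 0#) → Cases (meetCount H (quasi m))
      case-cᵣ (yes cᵣ≡0) = inj₂ (inj₁ (vertical-meetCount cᵣ≡0 m≡))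
      case-cᵣ (no cᵣ≢0)  = let v , e , coeff≡ , const≡ = graph-shape cᵣ≢0 in
        subst Cases (sym (graph-meetCount v e cᵣ≢0 coeff≡ const≡)) (case-c ((formSum m v - D e) ≟ 0#))

  -- Hyperplanes through a given point, and minimality.

  -- If the form vanished everywhere, `form-zeros` would give q² + 1 = 2q, against 2q ≤ q².
  form-nonzero-value : ∃ λ x → form x ≢ 0#
  form-nonzero-value with any? (λ x → ¬? (form x ≟ 0#))
  ... | yes w = w
  ... | no ¬w = ⊥-elim (ℕ.<-irrefl count-all (ℕ.≤-<-trans (ℕ.≤-trans (ℕ.≤-reflexive 2q) (ℕ.*-monoˡ-≤ q 2≤q)) (ℕ.n<1+n (q ℕ.* q))))
    where
    open ≡-Reasoning
    2q : q ℕ.+ q ≡ 2 ℕ.* q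
    2q = cong (q ℕ.+_) (sym (ℕ.+-identityʳ q))
    count-all : q ℕ.+ q ≡ suc (q ℕ.* q)
    count-all = begin
      q ℕ.+ q                             ≡⟨ form-zeros split ⟨
      ∑ (λ x → [ form x ≟ 0# ]) ℕ.+ 1     ≡⟨ cong (ℕ._+ 1) (∑-cong λ x → []-yes (form x ≟ 0#) (decidable-stable (form x ≟ 0#) λ nz → ¬w (x , nz))) ⟩
      ∑ (λ _ → 1) ℕ.+ 1                   ≡⟨ cong (ℕ._+ 1) (trans (∑-const 1) (trans (ℕ.*-identityʳ size) size≡q*q)) ⟩
      q ℕ.* q ℕ.+ 1                       ≡⟨ ℕ.+-comm _ 1 ⟩
      suc (q ℕ.* q)                       ∎

  []-1⇒ : {P : Set} (d : Dec P) → [ d ] ≡ 1 → P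
  []-1⇒ (yes p) _ = p

  form-0 : form 0# ≡ 0#
  form-0 = trans (form-σ 0#) (trans (cong (λ s → σ a * (s * s) - a * (0# * 0#) - β * (s * 0#)) σ-0) vanish)
    where
    vanish : σ a * (0# * 0#) - a * (0# * 0#) - β * (0# * 0#) ≡ 0#
    vanish = trans (cong (λ z → σ a * z - a * z - β * z) (zeroˡ 0#))
      (trans (solve 4 (λ A a β z → A :* z :- a :* z :- β :* z := (A :- a :- β) :* z) refl (σ a) a β 0#) (zeroʳ _))

  module Tangent {k} (P : Point (suc (suc k))) (P∈B : quasi (suc k) P ≡ true) where

    private
      m = suc k

      u : Point m
      u = P ∘ inject₁

      z x₀ : Carrier
      z  = P (fromℕ m)
      x₀ = proj₁ form-nonzero-value

      P-incident : D z + formSum m u ≡ 0#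
      P-incident = []-1⇒ ((D z + formSum m u) ≟ 0#) (trans (sym (indicator-quasi m P)) (cong indicator P∈B))

      -- Moves P onto a point with form sum form x₀.
      v : Point m
      v i = cons x₀ (λ _ → 0#) i - u i

      tilt e : Carrier
      tilt = sumFin m (λ i → slope (v i) * u i)
      -- The constant is forced by the requirement that the hyperplane contain `P`.
      e    = z - tilt

      c : Point (suc m)
      c = snoc (λ i → - slope (v i)) 1#

      last≡1 : c (fromℕ m) ≡ 1#
      last≡1 = snoc-fromℕ {m} (λ i → - slope (v i)) 1#

      last≢0 : c (fromℕ m) ≢ 0#
      last≢0 eq = 0≢1 (trans (sym eq) last≡1)

    hyperplane : Hyperplane (suc m)
    hyperplane = record { coeff = c ; const = e ; nonzero = fromℕ m , last≢0 }

    incidence : sumFin (suc m) (λ i → c i * P i) ≡ e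
    incidence = begin
      sumFin (suc m) (λ i → c i * P i)                        ≡⟨ sumFin-snoc m (λ i → c i * P i) ⟩
      sumFin m (λ i → c (inject₁ i) * u i) + c (fromℕ m) * z  ≡⟨ cong₂ _+_ (sumFin-cong m λ i → cong (_* u i) (snoc-inject₁ (λ j → - slope (v j)) 1# i))
                                                                   (trans (cong (_* z) last≡1) (*-identityˡ z)) ⟩
      sumFin m (λ i → - slope (v i) * u i) + z                ≡⟨ cong (_+ z) (sumFin-cong m λ i → solve 2 (λ s x → (:- s) :* x := :- (s :* x)) refl (slope (v i)) (u i)) ⟩
      sumFin m (λ i → - (slope (v i) * u i)) + z              ≡⟨ cong (_+ z) (sumFin-neg m (λ i → slope (v i) * u i)) ⟩
      - tilt + z                                              ≡⟨ +-comm _ _ ⟩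
      e                                                       ∎
      where open ≡-Reasoning

    -- As `P` lies on both the hyperplane and B(a,b), the constant of the section is the form sum at
    -- `u` translated by `v`. That point is (x₀, 0, ..., 0), so a single non-zero value of the form
    -- suffices in any dimension.
    section-constant : formSum m v - D e ≡ form x₀
    section-constant = begin
      formSum m v - D (z - tilt)                            ≡⟨ cong (λ d → formSum m v - d) (trans (cong (_- e) (σ-- z tilt))
                                                                 (solve 4 (λ z t s r → (s :- r) :- (z :- t) := (s :- z) :- (r :- t)) refl z tilt (σ z) (σ tilt))) ⟩
      formSum m v - (D z - D tilt)                          ≡⟨ solve 4 (λ g d t f → g :- (d :- t) := f :+ g :+ t :- (d :+ f)) refl (formSum m v) (D z) (D tilt) (formSum m u) ⟩
      formSum m u + formSum m v + D tilt - (D z + formSum m u)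
                                                            ≡⟨ cong₂ (λ p o → formSum m u + formSum m v + p - o) (D-sum m (λ i → slope (v i) * u i)) P-incident ⟩
      formSum m u + formSum m v + T - 0#                    ≡⟨ trans (cong (formSum m u + formSum m v + T +_) -0#≈0#) (+-identityʳ _) ⟩
      formSum m u + formSum m v + T                         ≡⟨ cong (_+ T) (sumFin-+ m (form ∘ u) (form ∘ v)) ⟨
      sumFin m (λ i → form (u i) + form (v i)) + T          ≡⟨ sumFin-+ m (λ i → form (u i) + form (v i)) (λ i → D (slope (v i) * u i)) ⟨
      sumFin m (λ i → form (u i) + form (v i) + D (slope (v i) * u i))
                                                            ≡⟨ sumFin-cong m (λ i → trans (sym (form-+ (u i) (v i)))
                                                                 (cong form (solve 2 (λ u t → u :+ (t :- u) := t) refl (u i) (t i)))) ⟩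
      form x₀ + sumFin k (λ _ → form 0#)                    ≡⟨ cong (form x₀ +_) (zero-sum k) ⟩
      form x₀ + 0#                                          ≡⟨ +-identityʳ _ ⟩
      form x₀                                               ∎
      where
      open ≡-Reasoning
      t : Point m
      t = cons x₀ (λ _ → 0#)
      T = sumFin m (λ i → D (slope (v i) * u i))
      zero-sum : ∀ n → sumFin n (λ _ → form 0#) ≡ 0#
      zero-sum zero    = refl
      zero-sum (suc n) = trans (cong₂ _+_ form-0 (zero-sum n)) (+-identityˡ 0#)

    meetCount≡offset : meetCount hyperplane (quasi m) ≡ offset m
    meetCount≡offset = begin
      meetCount hyperplane (quasi m)                                ≡⟨ graph-meetCount hyperplane v e last≢0 coeff≡ (sym (trans (cong (_* e) last≡1) (*-identityˡ e))) ⟩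
      offset m ℕ.+ q ℕ.^ m ℕ.* [ (formSum m v - D e) ≟ 0# ]         ≡⟨ cong (λ n → offset m ℕ.+ q ℕ.^ m ℕ.* n) ([]-no ((formSum m v - D e) ≟ 0#)
                                                                         λ eq → proj₂ form-nonzero-value (trans (sym section-constant) eq)) ⟩
      offset m ℕ.+ q ℕ.^ m ℕ.* 0                                    ≡⟨ cong (offset m ℕ.+_) (ℕ.*-zeroʳ (q ℕ.^ m)) ⟩
      offset m ℕ.+ 0                                                ≡⟨ ℕ.+-identityʳ _ ⟩
      offset m                                                      ∎
      where
      open ≡-Reasoning
      coeff≡ : ∀ i → c (inject₁ i) ≡ - (c (fromℕ m) * slope (v i))
      coeff≡ i = trans (snoc-inject₁ (λ j → - slope (v j)) 1# i)
                       (cong (-_) (sym (trans (cong (_* slope (v i)) last≡1) (*-identityˡ _))))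

    -- The summands compare pointwise, and strictly at `P`, which is a common point of the
    -- hyperplane and the set.
    removal : meetCount hyperplane (remove (quasi m) P) ℕ.< meetCount hyperplane (quasi m)
    removal = subst₂ ℕ._<_
      (sym (count-∑ᴾ (suc m) (λ x → onHyperplane hyperplane x ∧ remove (quasi m) P x)))
      (sym (count-∑ᴾ (suc m) (λ x → onHyperplane hyperplane x ∧ quasi m x)))
      (∑ᴾ-strict-mono (suc m) (λ x → ∧-mono (onHyperplane hyperplane x) (quasi m x) (samePoint x P)) P
        λ {x} x≗P → ∧-strict (onHyperplane hyperplane x) (quasi m x) (samePoint x P)
          ([]-yes (sumFin (suc m) (λ i → c i * x i) ≟ e) (trans (sumFin-cong (suc m) λ i → cong (c i *_) (x≗P i)) incidence))
          (trans (indicator-quasi m x) (trans (incident-cong m (x≗P ∘ inject₁) (x≗P (fromℕ m))) (trans (sym (indicator-quasi m P)) (cong indicator P∈B))))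
          ([]-yes (Fin.all? (λ i → x i ≟ P i)) x≗P))
      where
      ∧-mono : ∀ h s t → indicator (h ∧ (s ∧ not t)) ℕ.≤ indicator (h ∧ s)
      ∧-mono false s     t     = z≤n
      ∧-mono true  false t     = z≤n
      ∧-mono true  true  false = s≤s z≤n
      ∧-mono true  true  true  = z≤n
      ∧-strict : ∀ h s t → indicator h ≡ 1 → indicator s ≡ 1 → indicator t ≡ 1 →
                 indicator (h ∧ (s ∧ not t)) ℕ.< indicator (h ∧ s)
      ∧-strict true true true _ _ _ = s≤s z≤n

  size^*q : ∀ n → size ℕ.^ n ℕ.* q ≡ q ℕ.^ (2 ℕ.* n ℕ.+ 1)
  size^*q n = begin
    size ℕ.^ n ℕ.* q            ≡⟨ cong (λ s → s ℕ.^ n ℕ.* q) (trans size≡q*q (cong (q ℕ.*_) (sym (ℕ.*-identityʳ q)))) ⟩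
    (q ℕ.^ 2) ℕ.^ n ℕ.* q       ≡⟨ cong₂ ℕ._*_ (ℕ.^-*-assoc q 2 n) (sym (ℕ.*-identityʳ q)) ⟩
    q ℕ.^ (2 ℕ.* n) ℕ.* q ℕ.^ 1 ≡⟨ ℕ.^-distribˡ-+-* q (2 ℕ.* n) 1 ⟨
    q ℕ.^ (2 ℕ.* n ℕ.+ 1)       ∎
    where open ≡-Reasoning

  module _ (k : ℕ) where

    private
      m = suc k
      character₁ = q ℕ.^ (2 ℕ.* k ℕ.+ 1) ℕ.∸ q ℕ.^ k

    offset≡ : offset m ≡ character₁
    offset≡ = trans (sym (ℕ.m+n∸n≡m (offset m) (q ℕ.^ k))) (cong (ℕ._∸ q ℕ.^ k) (offset-closed k))

    characters : ∀ H → meetCount H (quasi m) ≡ character₁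
                     ⊎ meetCount H (quasi m) ≡ q ℕ.^ (2 ℕ.* k ℕ.+ 1)
                     ⊎ meetCount H (quasi m) ≡ character₁ ℕ.+ q ℕ.^ m
    characters H with meetCount-cases H refl
    ... | inj₁ eq        = inj₁ (trans eq offset≡)
    ... | inj₂ (inj₁ eq) = inj₂ (inj₁ (trans eq (size^*q k)))
    ... | inj₂ (inj₂ eq) = inj₂ (inj₂ (trans eq (cong (ℕ._+ q ℕ.^ m) offset≡)))

    character₁>0 : 0 ℕ.< character₁
    character₁>0 = ℕ.m<n⇒0<n∸m (ℕ.^-monoʳ-< q 2≤q (ℕ.≤-trans (s≤s (ℕ.m≤m+n k (k ℕ.+ 0))) (ℕ.≤-reflexive (ℕ.+-comm 1 (2 ℕ.* k)))))

    minimal : IsMinimalIntersectionSet character₁ (quasi m)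
    minimal = (character₁>0 , lower-bound) , λ P P∈B (_ , t≤) →
      let open Tangent P P∈B in
      ℕ.<⇒≱ (ℕ.<-≤-trans removal (ℕ.≤-reflexive (trans meetCount≡offset offset≡))) (t≤ hyperplane)
      where
      lower-bound : ∀ H → character₁ ℕ.≤ meetCount H (quasi m)
      lower-bound H with characters H
      ... | inj₁ eq        = ℕ.≤-reflexive (sym eq)
      ... | inj₂ (inj₁ eq) = ℕ.≤-trans (ℕ.m∸n≤m _ (q ℕ.^ k)) (ℕ.≤-reflexive (sym eq))
      ... | inj₂ (inj₂ eq) = ℕ.≤-trans (ℕ.m≤m+n character₁ (q ℕ.^ m)) (ℕ.≤-reflexive (sym eq))

-- From the prime power and the parity conditions to the theorem.

open import Defs
open import Data.Nat using (ℕ; _+_; _*_; _∸_; _^_; _≤_)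
open import Data.Nat.Divisibility using (_∣_)
open import Data.Nat.Primality using (Prime)
open import Data.Product using (_×_)
open import Data.Sum using (_⊎_)
open import Relation.Binary.PropositionalEquality using (_≡_; _≢_)
open import Relation.Nullary using (¬_)

even-prime-power : ∀ {p} → Prime p → ∀ h → 2 ∣ p ^ h → p ≡ 2
even-prime-power pp zero    2∣1 with ∣1⇒≡1 2∣1
... | ()
even-prime-power {p} pp (suc h) 2∣p^h with euclidsLemma p (p ^ h) prime[2] 2∣p^h
... | inj₂ 2∣ = even-prime-power pp h 2∣
... | inj₁ 2∣p with prime⇒irreducible pp 2∣p
...   | inj₂ 2≡p = sym 2≡p

module _ (F : FiniteField) {p h q : ℕ} (pp : Prime p) (1≤h : 1 ≤ h) (q≡p^h : q ≡ p ^ h)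
         (size≡q*q : FiniteField.size F ≡ q * q) where

  open Powers F using (CharacteristicDivides; characteristic-2; prime-power-characteristic; +-^-prime-power; 1+1≡0⇒2∣size)

  private
    characteristic : CharacteristicDivides p
    -- The field has q² = p^(2h) elements.
    characteristic = prime-power-characteristic p (h + h)
      (trans size≡q*q (trans (cong₂ _*_ q≡p^h q≡p^h) (sym (ℕ.^-distribˡ-+-* p h h))))

  square-order : SquareOrder F q
  square-order = record
    { 2≤q      = subst (2 ≤_) (sym q≡p^h) (ℕ.≤-trans (ℕ.nonTrivial⇒n>1 p {{prime⇒nonTrivial pp}})
                   (subst (_≤ p ^ h) (ℕ.*-identityʳ p) (ℕ.^-monoʳ-≤ p {{prime⇒nonZero pp}} 1≤h)))
    ; size≡q*q = size≡q*q
    ; +-^q     = subst (λ n → ∀ x y → FF._^_ F (FiniteField._+_ F x y) n ≡ FiniteField._+_ F (FF._^_ F x n) (FF._^_ F y n))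
                   (sym q≡p^h) (+-^-prime-power pp characteristic h)
    }

  open Conjugation F q square-order using (Split; odd-split; module EvenCharacteristic)

  -- The conditions speak of the parity of q and the two constructions of the characteristic. They
  -- are linked by Euclid's lemma: characteristic 2 would make q² and hence q even, and an even
  -- power of p forces p = 2.
  split-from-conditions : ∀ {a b} → a ≢ FiniteField.0# F → ¬ FF.InSubfield F q b →
    (¬ (2 ∣ q) × FF.OddCondition F q a b) ⊎ (2 ∣ q × FF.EvenCondition F h q a b) → Split a b
  split-from-conditions {b = b} a≢0 _ (inj₁ (2∤q , condition)) = odd-split b a≢0 2≢0 condition
    where
    2≢0 : FiniteField._+_ F (FiniteField.1# F) (FiniteField.1# F) ≢ FiniteField.0# F
    2≢0 eq = [ 2∤q , 2∤q ]′ (euclidsLemma q q prime[2] (subst (2 ∣_) size≡q*q (1+1≡0⇒2∣size eq)))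
  split-from-conditions {b = b} a≢0 b∉GFq (inj₂ (2∣q , condition)) =
    EvenCharacteristic.even-split 1+1≡0 h (trans q≡p^h (cong (_^ h) p≡2)) b a≢0 b∉GFq condition
    where
    p≡2 : p ≡ 2
    p≡2 = even-prime-power pp h (subst (2 ∣_) q≡p^h 2∣q)
    1+1≡0 : FiniteField._+_ F (FiniteField.1# F) (FiniteField.1# F) ≡ FiniteField.0# F
    1+1≡0 = characteristic-2 (subst CharacteristicDivides p≡2 characteristic)

theorem3p2 : (F : FiniteField) (p h q : ℕ) → Prime p → 1 ≤ h → q ≡ p ^ h →
    FiniteField.size F ≡ q * q →
    (r : ℕ) → 2 ≤ r → 2 ∣ r →
    (a b : FiniteField.Carrier F) →
    a ≢ FiniteField.0# F →
    ¬ FF.InSubfield F q b →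
    ((¬ (2 ∣ q) × FF.OddCondition F q a b) ⊎ (2 ∣ q × FF.EvenCondition F h q a b)) →
    FF.count F r (FF.Bset F q a b r) ≡ q ^ (2 * r ∸ 1)
    × (∀ (H : FF.Hyperplane F r) →
    (FF.meetCount F H (FF.Bset F q a b r) ≡ q ^ (2 * r ∸ 3) ∸ q ^ (r ∸ 2))
    ⊎ (FF.meetCount F H (FF.Bset F q a b r) ≡ q ^ (2 * r ∸ 3))
    ⊎ (FF.meetCount F H (FF.Bset F q a b r)
    ≡ q ^ (2 * r ∸ 3) ∸ q ^ (r ∸ 2) + q ^ (r ∸ 1)))
    × FF.IsMinimalIntersectionSet F (q ^ (2 * r ∸ 3) ∸ q ^ (r ∸ 2)) (FF.Bset F q a b r)
theorem3p2 F p h q _ _ _ _ 1 (s≤s ())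
theorem3p2 F p h q pp 1≤h q≡p^h size≡q*q (suc (suc k)) _ _ a b a≢0 b∉GFq condition =
    trans (quasi-count (suc k)) (trans (size^*q (suc k)) (cong (q ^_) (sym (cong (_∸ 1) (double (suc k))))))
  -- With r = k + 2 the exponents `r ∸ 2` and `r ∸ 1` compute to `k` and `suc k`; only `2 * r ∸ 3`
  -- has to be rewritten.
  , subst (λ e → ∀ H → FF.meetCount F H S ≡ q ^ e ∸ q ^ k ⊎ FF.meetCount F H S ≡ q ^ e ⊎ FF.meetCount F H S ≡ q ^ e ∸ q ^ k + q ^ suc k)
      exponent (characters k)
  , subst (λ e → FF.IsMinimalIntersectionSet F (q ^ e ∸ q ^ k) S) exponent (minimal k)
  where
  open QuasiHermitian F q (square-order F pp 1≤h q≡p^h size≡q*q) a b a≢0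
    (split-from-conditions F pp 1≤h q≡p^h size≡q*q a≢0 b∉GFq condition)
  S : FF.PointSet F (suc (suc k))
  S = FF.Bset F q a b (suc (suc k))
  double : ∀ n → 2 * suc n ≡ suc (2 * n + 1)
  double n = trans (ℕ.*-suc 2 n) (cong suc (ℕ.+-comm 1 (2 * n)))
  exponent : 2 * k + 1 ≡ 2 * suc (suc k) ∸ 3
  exponent = sym (trans (cong (_∸ 3) (double (suc k))) (trans (cong (_∸ 2) (ℕ.+-comm (2 * suc k) 1)) (cong (_∸ 1) (double k))))
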